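{- Let $\mathcal{C}$ be a cd-category with effect conditioning, let $G$ be a finite DAG with vertex set $V$, each vertex $X\in V$ being associated with an object of $\mathcal{C}$ (also denoted $X$), and let $\omega$ be a normalised state over $V$ which factorises according to $G$. Then for all pairwise disjoint subsets $Y,Z,W\subseteq V$: if $Y$ and $Z$ are d-separated by $W$ in $G$, then $(Y\perp\!\!\!\perp Z\mid W)_\omega$.
   Context: A cd-category is a symmetric monoidal category $(\mathcal{C},\otimes,I)$ (symmetry $\sigma$) in which every object $X$ carries $\Delta_X\colon X\to X\otimes X$ and $\epsilon_X\colon X\to I$ forming a commutative comonoid, compatible with the tensor ($\Delta_{X\otimes Y}=(\mathrm{id}\otimes\sigma\otimes\mathrm{id})\circ(\Delta_X\otimes\Delta_Y)$, $\epsilon_{X\otimes Y}=\epsilon_X\otimes\epsilon_Y$, $\Delta_I=\epsilon_I=\mathrm{id}_I$). A channel is $f\colon X\to Y$ with $\epsilon_Y\circ f=\epsilon_X$; a state $\omega\colon I\to X$ is normalised if $\epsilon_X\circ\omega=\mathrm{id}_I$. A partial channel is $f$ with $f=(f\otimes(\epsilon_Y\circ f))\circ\Delta_X$. Effect conditioning: $\mathcal{C}$ has (i) normalisation: a partial channel $\mathrm{norm}(f)$ for each $f\colon X\to Y$ with $f=(\mathrm{norm}(f)\otimes(\epsilon_Y\circ f))\circ\Delta_X$, $\mathrm{norm}(f)=f$ for partial channels $f$, $\mathrm{norm}(f\otimes g)=\mathrm{norm}(f)\otimes\mathrm{norm}(g)$, $\mathrm{norm}(\epsilon\circ f)=\epsilon\circ\mathrm{norm}(f)$,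 $\mathrm{norm}(f\circ\Delta_X)=\mathrm{norm}(f)\circ\Delta_X$ for $f\colon X\otimes X\to Y$; and (ii) cancellative caps: effects $\cap_X\colon X\otimes X\to I$ that are symmetric, satisfy $\cap_X\circ\Delta_X=\epsilon_X$, $(\cap_X\otimes\mathrm{id})\circ(\mathrm{id}\otimes\Delta_X)=(\mathrm{id}\otimes\cap_X)\circ(\Delta_X\otimes\mathrm{id})$, are compatible with $\otimes$ ($\cap_{X\otimes Y}=(\cap_X\otimes\cap_Y)\circ(\mathrm{id}\otimes\sigma\otimes\mathrm{id})$, $\cap_I=\mathrm{id}_I$), and such that $(\mathrm{id}_B\otimes\cap_X)\circ(f\otimes\mathrm{id}_X)=(\mathrm{id}_B\otimes\cap_X)\circ(g\otimes\mathrm{id}_X)$ implies $f=g$ for $f,g\colon A\to B\otimes X$. Conditionals: for $f\colon X\to Y\otimes Z$, $f|_Z:=\mathrm{norm}((\mathrm{id}_Y\otimes\cap_Z)\circ(f\otimes\mathrm{id}_Z))\colon X\otimes Z\to Y$. For a state $\omega$ over $V$ (i.e. of $\bigotimes_{X\in V}X$) and subsets $S\subseteq V$, $X_S=\bigotimes_{X\in S}X$, $\omega_S$ = marginal on $X_S$ (discard other factors), and for disjoint $S,T$, $\omega_{S|T}:=(\omega_{S\cup T})|_{X_T}\colon X_T\to X_S$. Conditional independence $(Y\perp\!\!\!\perp Z\mid W)_\omega$ means $\omega_{Y\cup Z|W}=(\omega_{Y|W}\otimes\omega_{Z|W})\circ\Delta_{X_W}$. Factorisation: $\omega$ factorises according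 to $G$ if there are channels $c_X\colon X_{\mathrm{Pa}(X)}\to X$ ($\mathrm{Pa}(X)$ = parents of $X$ in $G$) such that, for a topological ordering $X_1,\dots,X_n$ of $V$, with $\omega_0=\mathrm{id}_I$ and $\omega_k=(\mathrm{id}_{X_1\otimes\cdots\otimes X_{k-1}}\otimes(c_{X_k}\circ\pi_k))\circ\Delta_{X_1\otimes\cdots\otimes X_{k-1}}\circ\omega_{k-1}$, where $\pi_k\colon X_1\otimes\cdots\otimes X_{k-1}\to X_{\mathrm{Pa}(X_k)}$ discards the non-parents, one has $\omega=\omega_n$ (up to reordering factors). d-separation: a path (sequence of edges regardless of orientation) between two vertices is blocked by $W$ if it contains a chain $A\to M\to B$ or fork $A\leftarrow M\to B$ with $M\in W$, or a collider $A\to C\leftarrow B$ such that neither $C$ nor any descendant of $C$ is in $W$. $Y,Z$ are d-separated by $W$ if every path between a vertex of $Y$ and a vertex of $Z$ is blocked by $W$. -}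

module Defs where

open import Level using (Level; _⊔_; suc; Lift)
open import Data.Bool using (Bool; true; false)
open import Data.Unit using (⊤)
open import Data.Empty using (⊥)
open import Data.Product using (Σ; _×_; _,_; ∃; ∃-syntax)
open import Data.Sum using (_⊎_)
open import Data.Nat using (ℕ)
open import Data.Fin using (Fin; _<_)
open import Data.Fin.Subset using (Subset; _∈_; _∉_)
open import Data.Vec using () renaming (lookup to vlookup)
open import Data.List using (List; []; _∷_; map; allFin; reverse; length; lookup; last)
open import Data.List.Relation.Unary.Linked using (Linked)
open import Data.List.Relation.Unary.Unique.Propositional using (Unique)
open import Data.List.Relation.Binary.Permutation.Propositional using (_↭_)
open import Relation.Binary using (Rel; IsEquivalence)
open import Relation.Binary.PropositionalEquality using (_≡_)
open import Relation.Binary.Construct.Closure.ReflexiveTransitive using (Star)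
open import Data.Maybe using (just)

record SymMonCat (o ℓ e : Level) : Set (Level.suc (o ⊔ ℓ ⊔ e)) where
  infixr 9 _∘_
  infixr 10 _⊗₁_
  infixr 10 _⊗₀_
  infix 4 _≈_
  field
    Obj : Set o
    Hom : Obj → Obj → Set ℓ
    _≈_ : ∀ {A B} → Rel (Hom A B) e
    ≈-equiv : ∀ {A B} → IsEquivalence (_≈_ {A} {B})
    id  : ∀ {A} → Hom A A
    _∘_ : ∀ {A B C} → Hom B C → Hom A B → Hom A C
    ∘-assoc : ∀ {A B C D} {f : Hom A B} {g : Hom B C} {h : Hom C D} →
              (h ∘ g) ∘ f ≈ h ∘ (g ∘ f)
    identityˡ : ∀ {A B} {f : Hom A B} → id ∘ f ≈ f
    identityʳ : ∀ {A B} {f : Hom A B} → f ∘ id ≈ f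
    ∘-resp-≈ : ∀ {A B C} {f h : Hom B C} {g i : Hom A B} →
               f ≈ h → g ≈ i → f ∘ g ≈ h ∘ i
    _⊗₀_ : Obj → Obj → Obj
    I : Obj
    _⊗₁_ : ∀ {A B C D} → Hom A B → Hom C D → Hom (A ⊗₀ C) (B ⊗₀ D)
    ⊗-id : ∀ {A B} → id {A} ⊗₁ id {B} ≈ id
    ⊗-∘ : ∀ {A B C D E F} {f : Hom B C} {g : Hom A B} {h : Hom E F} {k : Hom D E} →
          (f ∘ g) ⊗₁ (h ∘ k) ≈ (f ⊗₁ h) ∘ (g ⊗₁ k)
    ⊗-resp-≈ : ∀ {A B C D} {f g : Hom A B} {h k : Hom C D} →
               f ≈ g → h ≈ k → f ⊗₁ h ≈ g ⊗₁ k
    assoc⇒ : ∀ {A B C} → Hom ((A ⊗₀ B) ⊗₀ C) (A ⊗₀ (B ⊗₀ C))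
    assoc⇐ : ∀ {A B C} → Hom (A ⊗₀ (B ⊗₀ C)) ((A ⊗₀ B) ⊗₀ C)
    unitˡ⇒ : ∀ {A} → Hom (I ⊗₀ A) A
    unitˡ⇐ : ∀ {A} → Hom A (I ⊗₀ A)
    unitʳ⇒ : ∀ {A} → Hom (A ⊗₀ I) A
    unitʳ⇐ : ∀ {A} → Hom A (A ⊗₀ I)
    σ : ∀ {A B} → Hom (A ⊗₀ B) (B ⊗₀ A)
    assoc-iso₁ : ∀ {A B C} → assoc⇒ {A} {B} {C} ∘ assoc⇐ ≈ id
    assoc-iso₂ : ∀ {A B C} → assoc⇐ {A} {B} {C} ∘ assoc⇒ ≈ id
    unitˡ-iso₁ : ∀ {A} → unitˡ⇒ {A} ∘ unitˡ⇐ ≈ id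
    unitˡ-iso₂ : ∀ {A} → unitˡ⇐ {A} ∘ unitˡ⇒ ≈ id
    unitʳ-iso₁ : ∀ {A} → unitʳ⇒ {A} ∘ unitʳ⇐ ≈ id
    unitʳ-iso₂ : ∀ {A} → unitʳ⇐ {A} ∘ unitʳ⇒ ≈ id
    σ-involutive : ∀ {A B} → σ {B} {A} ∘ σ {A} {B} ≈ id
    assoc-natural : ∀ {A B C D E F} {f : Hom A D} {g : Hom B E} {h : Hom C F} →
                    assoc⇒ ∘ ((f ⊗₁ g) ⊗₁ h) ≈ (f ⊗₁ (g ⊗₁ h)) ∘ assoc⇒
    unitˡ-natural : ∀ {A B} {f : Hom A B} → unitˡ⇒ ∘ (id ⊗₁ f) ≈ f ∘ unitˡ⇒
    unitʳ-natural : ∀ {A B} {f : Hom A B} → unitʳ⇒ ∘ (f ⊗₁ id) ≈ f ∘ unitʳ⇒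
    σ-natural : ∀ {A B C D} {f : Hom A B} {g : Hom C D} →
                σ ∘ (f ⊗₁ g) ≈ (g ⊗₁ f) ∘ σ
    pentagon : ∀ {A B C D} →
               assoc⇒ {A} {B} {C ⊗₀ D} ∘ assoc⇒ {A ⊗₀ B} {C} {D}
               ≈ (id ⊗₁ assoc⇒) ∘ (assoc⇒ ∘ (assoc⇒ ⊗₁ id))
    triangle : ∀ {A B} → (id {A} ⊗₁ unitˡ⇒ {B}) ∘ assoc⇒ ≈ unitʳ⇒ ⊗₁ id
    hexagon : ∀ {A B C} →
              assoc⇒ {B} {C} {A} ∘ (σ {A} {B ⊗₀ C} ∘ assoc⇒ {A} {B} {C})
              ≈ (id ⊗₁ σ) ∘ (assoc⇒ ∘ (σ ⊗₁ id))

  midswap : ∀ {A B C D} → Hom ((A ⊗₀ B) ⊗₀ (C ⊗₀ D)) ((A ⊗₀ C) ⊗₀ (B ⊗₀ D))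
  midswap = assoc⇐ ∘ ((id ⊗₁ (assoc⇒ ∘ ((σ ⊗₁ id) ∘ assoc⇐))) ∘ assoc⇒)

record CDCat (o ℓ e : Level) : Set (Level.suc (o ⊔ ℓ ⊔ e)) where
  field
    smc : SymMonCat o ℓ e
  open SymMonCat smc public
  field
    Δ : ∀ {X} → Hom X (X ⊗₀ X)
    ε : ∀ {X} → Hom X I
    counitˡ : ∀ {X} → unitˡ⇒ ∘ ((ε ⊗₁ id) ∘ Δ {X}) ≈ id
    counitʳ : ∀ {X} → unitʳ⇒ ∘ ((id ⊗₁ ε) ∘ Δ {X}) ≈ id
    coassoc : ∀ {X} → assoc⇒ ∘ ((Δ ⊗₁ id) ∘ Δ {X}) ≈ (id ⊗₁ Δ) ∘ Δ
    cocomm : ∀ {X} → σ ∘ Δ {X} ≈ Δ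
    Δ-⊗ : ∀ {X Y} → Δ {X ⊗₀ Y} ≈ midswap ∘ (Δ {X} ⊗₁ Δ {Y})
    ε-⊗ : ∀ {X Y} → ε {X ⊗₀ Y} ≈ unitˡ⇒ ∘ (ε {X} ⊗₁ ε {Y})
    Δ-I : Δ {I} ≈ unitˡ⇐
    ε-I : ε {I} ≈ id

  IsChannel : ∀ {X Y} → Hom X Y → Set e
  IsChannel f = ε ∘ f ≈ ε

  IsNormalisedState : ∀ {X} → Hom I X → Set e
  IsNormalisedState ω = ε ∘ ω ≈ id

  IsPartialChannel : ∀ {X Y} → Hom X Y → Set e
  IsPartialChannel f = f ≈ unitʳ⇒ ∘ ((f ⊗₁ (ε ∘ f)) ∘ Δ)

record EffectConditioning {o ℓ e} (C : CDCat o ℓ e) : Set (o ⊔ ℓ ⊔ e) where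
  open CDCat C
  field
    norm : ∀ {X Y} → Hom X Y → Hom X Y
    cap  : ∀ {X} → Hom (X ⊗₀ X) I
  capApply : ∀ {A B X} → Hom A (B ⊗₀ X) → Hom (A ⊗₀ X) B
  capApply f = unitʳ⇒ ∘ ((id ⊗₁ cap) ∘ (assoc⇒ ∘ (f ⊗₁ id)))
  field
    norm-resp-≈ : ∀ {X Y} {f g : Hom X Y} → f ≈ g → norm f ≈ norm g
    norm-partial : ∀ {X Y} (f : Hom X Y) → IsPartialChannel (norm f)
    norm-eq : ∀ {X Y} (f : Hom X Y) → f ≈ unitʳ⇒ ∘ ((norm f ⊗₁ (ε ∘ f)) ∘ Δ)
    norm-id : ∀ {X Y} (f : Hom X Y) → IsPartialChannel f → norm f ≈ f
    norm-⊗ : ∀ {A B C D} (f : Hom A B) (g : Hom C D) → norm (f ⊗₁ g) ≈ norm f ⊗₁ norm g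
    norm-ε : ∀ {X Y} (f : Hom X Y) → norm (ε ∘ f) ≈ ε ∘ norm f
    norm-Δ : ∀ {X Y} (f : Hom (X ⊗₀ X) Y) → norm (f ∘ Δ) ≈ norm f ∘ Δ
    cap-sym : ∀ {X} → cap {X} ∘ σ ≈ cap
    cap-Δ : ∀ {X} → cap {X} ∘ Δ ≈ ε
    cap-snake : ∀ {X} → unitˡ⇒ ∘ ((cap {X} ⊗₁ id) ∘ (assoc⇐ ∘ (id ⊗₁ Δ)))
                        ≈ unitʳ⇒ ∘ ((id ⊗₁ cap {X}) ∘ (assoc⇒ ∘ (Δ ⊗₁ id)))
    cap-⊗ : ∀ {X Y} → cap {X ⊗₀ Y} ≈ unitˡ⇒ ∘ ((cap {X} ⊗₁ cap {Y}) ∘ midswap)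
    cap-I : cap {I} ≈ unitˡ⇒
    cap-cancel : ∀ {A B X} (f g : Hom A (B ⊗₀ X)) → capApply f ≈ capApply g → f ≈ g

  cond : ∀ {X Y Z} → Hom X (Y ⊗₀ Z) → Hom (X ⊗₀ Z) Y
  cond f = norm (capApply f)

module Multi {o ℓ e} (C : CDCat o ℓ e) where
  open CDCat C

  ⨂ : List Obj → Obj
  ⨂ [] = I
  ⨂ (x ∷ []) = x
  ⨂ (x ∷ y ∷ xs) = x ⊗₀ ⨂ (y ∷ xs)

  cons-in : ∀ {x} (xs : List Obj) → Hom (x ⊗₀ ⨂ xs) (⨂ (x ∷ xs))
  cons-in [] = unitʳ⇒
  cons-in (_ ∷ _) = id

  cons-out : ∀ {x} (xs : List Obj) → Hom (⨂ (x ∷ xs)) (x ⊗₀ ⨂ xs)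
  cons-out [] = unitʳ⇐
  cons-out (_ ∷ _) = id

  pushR : ∀ {x A B} → Hom (x ⊗₀ (A ⊗₀ B)) (A ⊗₀ (x ⊗₀ B))
  pushR = assoc⇒ ∘ ((σ ⊗₁ id) ∘ assoc⇐)

  dropL : ∀ {x A} → Hom (x ⊗₀ A) A
  dropL = unitˡ⇒ ∘ (ε ⊗₁ id)

  module Vertices {n : ℕ} (obj : Fin n → Obj) where

    consIf : Bool → Fin n → List (Fin n) → List (Fin n)
    consIf true v K = v ∷ K
    consIf false v K = K

    keep : (Fin n → Bool) → List (Fin n) → List (Fin n)
    keep p [] = []
    keep p (v ∷ L) = consIf (p v) v (keep p L)

    X : List (Fin n) → Obj
    X L = ⨂ (map obj L)

    put : (b : Bool) (v : Fin n) (K : List (Fin n)) → Hom (obj v ⊗₀ X K) (X (consIf b v K))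
    put true v K = cons-in (map obj K)
    put false v K = dropL

    step2 : (a b : Bool) (v : Fin n) (K₁ K₂ : List (Fin n)) →
            Hom (obj v ⊗₀ (X K₁ ⊗₀ X K₂)) (X (consIf a v K₁) ⊗₀ X (consIf b v K₂))
    step2 true true v K₁ K₂ = (cons-in (map obj K₁) ⊗₁ cons-in (map obj K₂)) ∘ (midswap ∘ (Δ ⊗₁ id))
    step2 true false v K₁ K₂ = (cons-in (map obj K₁) ⊗₁ id) ∘ assoc⇐
    step2 false true v K₁ K₂ = (id ⊗₁ cons-in (map obj K₂)) ∘ pushR
    step2 false false v K₁ K₂ = dropL

    step3 : (a b c : Bool) (v : Fin n) (K₁ K₂ K₃ : List (Fin n)) →
            Hom (obj v ⊗₀ ((X K₁ ⊗₀ X K₂) ⊗₀ X K₃))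
                ((X (consIf a v K₁) ⊗₀ X (consIf b v K₂)) ⊗₀ X (consIf c v K₃))
    step3 false false false v K₁ K₂ K₃ = dropL
    step3 false false true v K₁ K₂ K₃ = (id ⊗₁ cons-in (map obj K₃)) ∘ pushR
    step3 true b true v K₁ K₂ K₃ =
      (step2 true b v K₁ K₂ ⊗₁ cons-in (map obj K₃)) ∘ (midswap ∘ (Δ ⊗₁ id))
    step3 false true true v K₁ K₂ K₃ =
      (step2 false true v K₁ K₂ ⊗₁ cons-in (map obj K₃)) ∘ (midswap ∘ (Δ ⊗₁ id))
    step3 true b false v K₁ K₂ K₃ = (step2 true b v K₁ K₂ ⊗₁ id) ∘ assoc⇐
    step3 false true false v K₁ K₂ K₃ = (step2 false true v K₁ K₂ ⊗₁ id) ∘ assoc⇐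

    marg : (p : Fin n → Bool) (L : List (Fin n)) → Hom (X L) (X (keep p L))
    marg p [] = id
    marg p (v ∷ L) = put (p v) v (keep p L) ∘ ((id ⊗₁ marg p L) ∘ cons-out (map obj L))

    -- X_L → X_S ⊗ X_T  (discarding the other factors; S, T will be disjoint)
    split2 : (S T : Subset n) (L : List (Fin n)) →
             Hom (X L) (X (keep (vlookup S) L) ⊗₀ X (keep (vlookup T) L))
    split2 S T [] = unitˡ⇐
    split2 S T (v ∷ L) =
      step2 (vlookup S v) (vlookup T v) v (keep (vlookup S) L) (keep (vlookup T) L) ∘
      ((id ⊗₁ split2 S T L) ∘ cons-out (map obj L))

    split3 : (Y Z W : Subset n) (L : List (Fin n)) →
             Hom (X L) ((X (keep (vlookup Y) L) ⊗₀ X (keep (vlookup Z) L))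
                        ⊗₀ X (keep (vlookup W) L))
    split3 Y Z W [] = (unitˡ⇐ ⊗₁ id) ∘ unitˡ⇐
    split3 Y Z W (v ∷ L) =
      step3 (vlookup Y v) (vlookup Z v) (vlookup W v) v
            (keep (vlookup Y) L) (keep (vlookup Z) L) (keep (vlookup W) L) ∘
      ((id ⊗₁ split3 Y Z W L) ∘ cons-out (map obj L))

    module Conditionals (EC : EffectConditioning C) (L : List (Fin n))
                        (ω : Hom I (X L)) where
      open EffectConditioning EC

      X[_] : Subset n → Obj
      X[ S ] = X (keep (vlookup S) L)

      cond₁ : (S T : Subset n) → Hom X[ T ] X[ S ]
      cond₁ S T = cond (split2 S T L ∘ ω) ∘ unitˡ⇐

      cond₂ : (Y Z W : Subset n) → Hom X[ W ] (X[ Y ] ⊗₀ X[ Z ])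
      cond₂ Y Z W = cond (split3 Y Z W L ∘ ω) ∘ unitˡ⇐

      CondIndep : (Y Z W : Subset n) → Set e
      CondIndep Y Z W = cond₂ Y Z W ≈ (cond₁ Y W ⊗₁ cond₁ Z W) ∘ Δ

    module Factorisation (E : Fin n → Fin n → Bool) where
      parent : Fin n → Fin n → Bool
      parent v u = E u v

      -- one channel c_v : X_{Pa(v)} → v per vertex of L, where the parents
      -- are drawn from the vertices after v in L (= earlier in the order)
      Channels : List (Fin n) → Set (ℓ ⊔ e)
      Channels [] = Lift (ℓ ⊔ e) ⊤
      Channels (v ∷ L) =
        Σ (Hom (X (keep (parent v) L)) (obj v)) IsChannel × Channels L

      build : (L : List (Fin n)) → Channels L → Hom I (X L)
      build [] _ = id
      build (v ∷ L) ((c , _) , cs) =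
        cons-in (map obj L) ∘ (((c ∘ marg (parent v) L) ⊗₁ id) ∘ (Δ ∘ build L cs))

      Factorises : (τ : List (Fin n)) → Hom I (X (reverse τ)) → Set (ℓ ⊔ e)
      Factorises τ ω = Σ (Channels (reverse τ)) λ cs → ω ≈ build (reverse τ) cs

module Graph {n : ℕ} (E : Fin n → Fin n → Bool) where

  Edge : Fin n → Fin n → Set
  Edge u v = E u v ≡ true

  IsTopOrder : List (Fin n) → Set
  IsTopOrder τ = (τ ↭ allFin n) ×
    (∀ (i j : Fin (length τ)) → Edge (lookup τ i) (lookup τ j) → i < j)

  Adjacent : Fin n → Fin n → Set
  Adjacent u v = Edge u v ⊎ Edge v u

  Descendant : Fin n → Fin n → Set
  Descendant c d = Star Edge c d

  record Path (y z : Fin n) : Set where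
    field
      verts  : List (Fin n)
      linked : Linked Adjacent (y ∷ verts)
      simple : Unique (y ∷ verts)
      ends   : last (y ∷ verts) ≡ just z

  data Consecutive (a m b : Fin n) : List (Fin n) → Set where
    here  : ∀ {xs} → Consecutive a m b (a ∷ m ∷ b ∷ xs)
    there : ∀ {x xs} → Consecutive a m b xs → Consecutive a m b (x ∷ xs)

  BlocksAt : Subset n → Fin n → Fin n → Fin n → Set
  BlocksAt W a m b =
      (m ∈ W × ((Edge a m × Edge m b) ⊎ (Edge b m × Edge m a) ⊎ (Edge m a × Edge m b)))
    ⊎ ((Edge a m × Edge b m) × (∀ d → Descendant m d → d ∉ W))

  Blocked : Subset n → ∀ {y z} → Path y z → Set
  Blocked W {y} p = ∃[ a ] ∃[ m ] ∃[ b ]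
    (Consecutive a m b (y ∷ Path.verts p) × BlocksAt W a m b)

  DSeparated : Subset n → Subset n → Subset n → Set
  DSeparated Y Z W = ∀ y z → y ∈ Y → z ∈ Z → (p : Path y z) → Blocked W p

Disjoint : ∀ {n} → Subset n → Subset n → Set
Disjoint S T = ∀ v → v ∈ S → v ∈ T → ⊥

{-# OPTIONS --safe #-}
module Submission where

-- Total copyable morphisms form a cartesian category, so all the bookkeeping maps between
-- tensor products can be compared on projections.  Let A be the set of ancestors of
-- Y ∪ Z ∪ W, and split A \ W into the vertices that active trails from Y reach and the rest.
-- By d-separation Z lies in the second part, and the parents of any vertex of A lie, up to
-- vertices of W, in a single part.  Bending the W-outputs of ω down with caps and then
-- integrating out the vertices from the last to the first, every mechanism can therefore be
-- absorbed into one of two factors (the snake equation lets an observed vertex be replaced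
-- by its observed value), so that the unnormalised conditional is (f ⊗ g) ∘ Δ.  Since norm
-- commutes with ⊗ and Δ, the normalised conditional is the product of its marginals.

open import Defs
open import Level using (Level; _⊔_)
open import Data.Bool using (Bool; true; false)
open import Data.Bool.Properties using () renaming (_≟_ to _≟ᵇ_)
open import Data.Empty using (⊥)
open import Data.Nat using (ℕ)
open import Data.Fin using (Fin)
open import Data.Fin.Properties using (any?; <-asym) renaming (_≟_ to _≟ᶠ_)
open import Data.Fin.Subset using (Subset; _∈_; _∉_)
open import Data.Fin.Subset.Properties using (_∈?_)
open import Data.List using (List; []; _∷_; map; reverse; allFin; last; cartesianProduct)
open import Data.List.Membership.Propositional using () renaming (_∈_ to _∈ˡ_)
open import Data.List.Membership.Propositional.Properties using (∈-allFin; ∈-cartesianProduct⁺)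
import Data.List.Membership.DecPropositional as DecMembership
open import Data.List.Relation.Binary.Permutation.Propositional using (↭-sym)
open import Data.List.Relation.Binary.Permutation.Propositional.Properties using (∈-resp-↭)
open import Data.List.Relation.Unary.All using ([])
open import Data.List.Relation.Unary.All.Properties using (¬Any⇒All¬)
open import Data.List.Relation.Unary.AllPairs using ([]; _∷_)
open import Data.List.Relation.Unary.Any using (here; there; index)
open import Data.List.Relation.Unary.Any.Properties using (lookup-index)
open import Data.List.Relation.Unary.Linked using (Linked; [-]; _∷_)
open import Data.List.Relation.Unary.Unique.Propositional using (Unique)
open import Data.Maybe using (just)
open import Data.Product using (Σ-syntax; ∃-syntax; _×_; _,_; proj₂; uncurry)
open import Data.Sum using (_⊎_; inj₁; inj₂)
open import Data.Vec using () renaming (lookup to vlookup)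
open import Data.Vec.Properties using ([]=⇒lookup; lookup⇒[]=)
open import Relation.Binary using (Setoid; IsEquivalence)
open import Relation.Binary.Construct.Closure.ReflexiveTransitive using (Star; _◅_; _◅◅_) renaming (ε to stop)
open import Relation.Binary.PropositionalEquality using (_≡_; refl; sym; trans; subst₂)
import Relation.Binary.Reasoning.Setoid as SetoidReasoning
open import Relation.Nullary using (Dec; yes; no; does; ¬_; ¬?; contradiction)
open import Relation.Nullary.Decidable using (_×-dec_; _⊎-dec_; map′; dec-true; dec-false)

-- The obstacle on the categorical side is that mechanisms and states are not deterministic, so
-- running one does not distribute over a pair. It does when one component ignores the output. Hence
-- each factor must record which variables it may use (`DependsOn`), and a vertex used by both
-- factors must be observed: it is replaced by a deterministic value before its mechanism is
-- integrated out. The head of `reverse τ` is the last vertex, its parents are in the tail, and so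
-- the elimination is an induction on the list. A second obstacle is that the marginals of
-- `⟨ f , g ⟩` are not `f` and `g`: each is reweighted by the mass of the other. Normalisation turns
-- this weight into an idempotent effect such as `ε ∘ norm g`, which both components may share. On
-- the graph side, reachability yields walks while d-separation quantifies over simple paths.
-- Cutting out a loop can change whether the splice vertex is a collider, and the marks on walks
-- exist to repair this. The two sides must be Boolean functions, so reachability has to be decided.

-- The cartesian calculus of deterministic maps.

module CopyDiscard {o ℓ e : Level} (C : CDCat o ℓ e) where
  open CDCat C

  module HomReasoning {A B : Obj} where
    private
      homSetoid : Setoid ℓ e
      homSetoid = record { isEquivalence = ≈-equiv {A} {B} }
    open IsEquivalence (≈-equiv {A} {B}) public
      renaming (refl to ≈-refl; sym to ≈-sym; trans to ≈-trans)
    open SetoidReasoning homSetoid public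
  open HomReasoning

  open Multi C using (pushR)

  private variable
    A B X Y : Obj
    f g h k d : Hom A B

  infixr 4 refl⟩∘⟨_
  infixl 5 _⟩∘⟨refl

  refl⟩∘⟨_ : g ≈ h → f ∘ g ≈ f ∘ h
  refl⟩∘⟨ eq = ∘-resp-≈ ≈-refl eq

  _⟩∘⟨refl : f ≈ h → f ∘ g ≈ h ∘ g
  eq ⟩∘⟨refl = ∘-resp-≈ eq ≈-refl

  pullˡ : f ∘ g ≈ h → f ∘ (g ∘ k) ≈ h ∘ k
  pullˡ eq = ≈-trans (≈-sym ∘-assoc) (eq ⟩∘⟨refl)

  cancelˡ : f ∘ g ≈ id → f ∘ (g ∘ k) ≈ k
  cancelˡ eq = ≈-trans (pullˡ eq) identityˡ

  ⊗-resp-id : f ≈ id → g ≈ id → f ⊗₁ g ≈ id {A ⊗₀ B}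
  ⊗-resp-id p q = ≈-trans (⊗-resp-≈ p q) ⊗-id

  -- Formed for arbitrary morphisms. It satisfies both projection laws when the components are
  -- channels, and commutes with precomposition by deterministic maps.
  ⟨_,_⟩ : Hom A X → Hom A Y → Hom A (X ⊗₀ Y)
  ⟨ f , g ⟩ = (f ⊗₁ g) ∘ Δ

  ⟨⟩-cong : f ≈ h → g ≈ k → ⟨ f , g ⟩ ≈ ⟨ h , k ⟩
  ⟨⟩-cong p q = ⊗-resp-≈ p q ⟩∘⟨refl

  ⊗-∘-⟨⟩ : (h ⊗₁ k) ∘ ⟨ f , g ⟩ ≈ ⟨ h ∘ f , k ∘ g ⟩
  ⊗-∘-⟨⟩ = pullˡ (≈-sym ⊗-∘)

  Δ-⟨⟩ : Δ ≈ ⟨ id {A} , id ⟩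
  Δ-⟨⟩ = ≈-sym (≈-trans (⊗-id ⟩∘⟨refl) identityˡ)

  assoc-⟨⟩ : assoc⇒ ∘ ⟨ ⟨ f , g ⟩ , h ⟩ ≈ ⟨ f , ⟨ g , h ⟩ ⟩
  assoc-⟨⟩ {f = f} {g = g} {h = h} = begin
    assoc⇒ ∘ ⟨ ⟨ f , g ⟩ , h ⟩                      ≈⟨ refl⟩∘⟨ ⟨⟩-cong ≈-refl identityʳ ⟨
    assoc⇒ ∘ ⟨ (f ⊗₁ g) ∘ Δ , h ∘ id ⟩              ≈⟨ refl⟩∘⟨ ⊗-∘-⟨⟩ ⟨
    assoc⇒ ∘ (((f ⊗₁ g) ⊗₁ h) ∘ ⟨ Δ , id ⟩)         ≈⟨ pullˡ assoc-natural ⟩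
    ((f ⊗₁ (g ⊗₁ h)) ∘ assoc⇒) ∘ ⟨ Δ , id ⟩         ≈⟨ ∘-assoc ⟩
    (f ⊗₁ (g ⊗₁ h)) ∘ (assoc⇒ ∘ ⟨ Δ , id ⟩)         ≈⟨ refl⟩∘⟨ coassoc ⟩
    (f ⊗₁ (g ⊗₁ h)) ∘ ⟨ id , Δ ⟩                    ≈⟨ ⊗-∘-⟨⟩ ⟩
    ⟨ f ∘ id , ⟨ g , h ⟩ ⟩                          ≈⟨ ⟨⟩-cong identityʳ ≈-refl ⟩
    ⟨ f , ⟨ g , h ⟩ ⟩                               ∎

  assoc⇐-⟨⟩ : assoc⇐ ∘ ⟨ f , ⟨ g , h ⟩ ⟩ ≈ ⟨ ⟨ f , g ⟩ , h ⟩
  assoc⇐-⟨⟩ = ≈-trans (refl⟩∘⟨ ≈-sym assoc-⟨⟩) (cancelˡ assoc-iso₂)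

  σ-⟨⟩ : σ ∘ ⟨ f , g ⟩ ≈ ⟨ g , f ⟩
  σ-⟨⟩ = ≈-trans (pullˡ σ-natural) (≈-trans ∘-assoc (refl⟩∘⟨ cocomm))

  unitˡ-⟨⟩ : unitˡ⇒ ∘ ⟨ ε , f ⟩ ≈ f
  unitˡ-⟨⟩ {f = f} = begin
    unitˡ⇒ ∘ ⟨ ε , f ⟩                ≈⟨ refl⟩∘⟨ ⟨⟩-cong identityˡ identityʳ ⟨
    unitˡ⇒ ∘ ⟨ id ∘ ε , f ∘ id ⟩      ≈⟨ refl⟩∘⟨ ⊗-∘-⟨⟩ ⟨
    unitˡ⇒ ∘ (id ⊗₁ f) ∘ ⟨ ε , id ⟩   ≈⟨ pullˡ unitˡ-natural ⟩
    (f ∘ unitˡ⇒) ∘ ⟨ ε , id ⟩         ≈⟨ ∘-assoc ⟩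
    f ∘ unitˡ⇒ ∘ ⟨ ε , id ⟩           ≈⟨ refl⟩∘⟨ counitˡ ⟩
    f ∘ id                            ≈⟨ identityʳ ⟩
    f                                 ∎

  unitʳ-⟨⟩ : unitʳ⇒ ∘ ⟨ f , ε ⟩ ≈ f
  unitʳ-⟨⟩ {f = f} = begin
    unitʳ⇒ ∘ ⟨ f , ε ⟩                ≈⟨ refl⟩∘⟨ ⟨⟩-cong identityʳ identityˡ ⟨
    unitʳ⇒ ∘ ⟨ f ∘ id , id ∘ ε ⟩      ≈⟨ refl⟩∘⟨ ⊗-∘-⟨⟩ ⟨
    unitʳ⇒ ∘ (f ⊗₁ id) ∘ ⟨ id , ε ⟩   ≈⟨ pullˡ unitʳ-natural ⟩
    (f ∘ unitʳ⇒) ∘ ⟨ id , ε ⟩         ≈⟨ ∘-assoc ⟩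
    f ∘ unitʳ⇒ ∘ ⟨ id , ε ⟩           ≈⟨ refl⟩∘⟨ counitʳ ⟩
    f ∘ id                            ≈⟨ identityʳ ⟩
    f                                 ∎

  unitˡ⇐-⟨⟩ : unitˡ⇐ ≈ ⟨ ε , id {A} ⟩
  unitˡ⇐-⟨⟩ = ≈-trans (≈-sym identityʳ) (≈-trans (refl⟩∘⟨ ≈-sym counitˡ) (cancelˡ unitˡ-iso₂))

  unitʳ⇐-⟨⟩ : unitʳ⇐ ≈ ⟨ id {A} , ε ⟩
  unitʳ⇐-⟨⟩ = ≈-trans (≈-sym identityʳ) (≈-trans (refl⟩∘⟨ ≈-sym counitʳ) (cancelˡ unitʳ-iso₂))

  σ⊗id-⟨⟩ : assoc⇒ ∘ ((σ ⊗₁ id) ∘ assoc⇐) ∘ ⟨ f , ⟨ g , h ⟩ ⟩ ≈ ⟨ g , ⟨ f , h ⟩ ⟩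
  σ⊗id-⟨⟩ {f = f} {g = g} {h = h} = begin
    assoc⇒ ∘ ((σ ⊗₁ id) ∘ assoc⇐) ∘ ⟨ f , ⟨ g , h ⟩ ⟩   ≈⟨ refl⟩∘⟨ ∘-assoc ⟩
    assoc⇒ ∘ (σ ⊗₁ id) ∘ assoc⇐ ∘ ⟨ f , ⟨ g , h ⟩ ⟩     ≈⟨ refl⟩∘⟨ refl⟩∘⟨ assoc⇐-⟨⟩ ⟩
    assoc⇒ ∘ (σ ⊗₁ id) ∘ ⟨ ⟨ f , g ⟩ , h ⟩              ≈⟨ refl⟩∘⟨ ⊗-∘-⟨⟩ ⟩
    assoc⇒ ∘ ⟨ σ ∘ ⟨ f , g ⟩ , id ∘ h ⟩                 ≈⟨ refl⟩∘⟨ ⟨⟩-cong σ-⟨⟩ identityˡ ⟩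
    assoc⇒ ∘ ⟨ ⟨ g , f ⟩ , h ⟩                          ≈⟨ assoc-⟨⟩ ⟩
    ⟨ g , ⟨ f , h ⟩ ⟩                                   ∎

  pushR-⟨⟩ : pushR ∘ ⟨ f , ⟨ g , h ⟩ ⟩ ≈ ⟨ g , ⟨ f , h ⟩ ⟩
  pushR-⟨⟩ = ≈-trans ∘-assoc σ⊗id-⟨⟩

  midswap-⟨⟩ : midswap ∘ ⟨ ⟨ f , g ⟩ , ⟨ h , k ⟩ ⟩ ≈ ⟨ ⟨ f , h ⟩ , ⟨ g , k ⟩ ⟩
  midswap-⟨⟩ {f = f} {g = g} {h = h} {k = k} = begin
    midswap ∘ ⟨ ⟨ f , g ⟩ , ⟨ h , k ⟩ ⟩                         ≈⟨ ∘-assoc ⟩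
    assoc⇐ ∘ ((id ⊗₁ pushR) ∘ assoc⇒) ∘ ⟨ ⟨ f , g ⟩ , ⟨ h , k ⟩ ⟩ ≈⟨ refl⟩∘⟨ ∘-assoc ⟩
    assoc⇐ ∘ (id ⊗₁ pushR) ∘ assoc⇒ ∘ ⟨ ⟨ f , g ⟩ , ⟨ h , k ⟩ ⟩ ≈⟨ refl⟩∘⟨ refl⟩∘⟨ assoc-⟨⟩ ⟩
    assoc⇐ ∘ (id ⊗₁ pushR) ∘ ⟨ f , ⟨ g , ⟨ h , k ⟩ ⟩ ⟩          ≈⟨ refl⟩∘⟨ ⊗-∘-⟨⟩ ⟩
    assoc⇐ ∘ ⟨ id ∘ f , pushR ∘ ⟨ g , ⟨ h , k ⟩ ⟩ ⟩             ≈⟨ refl⟩∘⟨ ⟨⟩-cong identityˡ pushR-⟨⟩ ⟩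
    assoc⇐ ∘ ⟨ f , ⟨ h , ⟨ g , k ⟩ ⟩ ⟩                          ≈⟨ assoc⇐-⟨⟩ ⟩
    ⟨ ⟨ f , h ⟩ , ⟨ g , k ⟩ ⟩                                   ∎

  assoc⇐-natural : assoc⇐ ∘ (f ⊗₁ (g ⊗₁ h)) ≈ ((f ⊗₁ g) ⊗₁ h) ∘ assoc⇐
  assoc⇐-natural {f = f} {g = g} {h = h} = begin
    assoc⇐ ∘ (f ⊗₁ (g ⊗₁ h))                          ≈⟨ refl⟩∘⟨ identityʳ ⟨
    assoc⇐ ∘ (f ⊗₁ (g ⊗₁ h)) ∘ id                     ≈⟨ refl⟩∘⟨ refl⟩∘⟨ assoc-iso₁ ⟨
    assoc⇐ ∘ (f ⊗₁ (g ⊗₁ h)) ∘ assoc⇒ ∘ assoc⇐        ≈⟨ refl⟩∘⟨ pullˡ (≈-sym assoc-natural) ⟩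
    assoc⇐ ∘ (assoc⇒ ∘ ((f ⊗₁ g) ⊗₁ h)) ∘ assoc⇐      ≈⟨ refl⟩∘⟨ ∘-assoc ⟩
    assoc⇐ ∘ assoc⇒ ∘ ((f ⊗₁ g) ⊗₁ h) ∘ assoc⇐        ≈⟨ cancelˡ assoc-iso₂ ⟩
    ((f ⊗₁ g) ⊗₁ h) ∘ assoc⇐                          ∎

  pushR-natural : pushR ∘ (f ⊗₁ (g ⊗₁ h)) ≈ (g ⊗₁ (f ⊗₁ h)) ∘ pushR
  pushR-natural {f = f} {g = g} {h = h} = begin
    pushR ∘ (f ⊗₁ (g ⊗₁ h))                             ≈⟨ ∘-assoc ⟩
    assoc⇒ ∘ ((σ ⊗₁ id) ∘ assoc⇐) ∘ (f ⊗₁ (g ⊗₁ h))     ≈⟨ refl⟩∘⟨ ∘-assoc ⟩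
    assoc⇒ ∘ (σ ⊗₁ id) ∘ assoc⇐ ∘ (f ⊗₁ (g ⊗₁ h))       ≈⟨ refl⟩∘⟨ refl⟩∘⟨ assoc⇐-natural ⟩
    assoc⇒ ∘ (σ ⊗₁ id) ∘ ((f ⊗₁ g) ⊗₁ h) ∘ assoc⇐       ≈⟨ refl⟩∘⟨ pullˡ (≈-sym ⊗-∘) ⟩
    assoc⇒ ∘ ((σ ∘ (f ⊗₁ g)) ⊗₁ (id ∘ h)) ∘ assoc⇐      ≈⟨ refl⟩∘⟨ ⊗-resp-≈ σ-natural (≈-trans identityˡ (≈-sym identityʳ)) ⟩∘⟨refl ⟩
    assoc⇒ ∘ (((g ⊗₁ f) ∘ σ) ⊗₁ (h ∘ id)) ∘ assoc⇐      ≈⟨ refl⟩∘⟨ ≈-trans (⊗-∘ ⟩∘⟨refl) ∘-assoc ⟩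
    assoc⇒ ∘ ((g ⊗₁ f) ⊗₁ h) ∘ (σ ⊗₁ id) ∘ assoc⇐       ≈⟨ pullˡ assoc-natural ⟩
    ((g ⊗₁ (f ⊗₁ h)) ∘ assoc⇒) ∘ (σ ⊗₁ id) ∘ assoc⇐     ≈⟨ ∘-assoc ⟩
    (g ⊗₁ (f ⊗₁ h)) ∘ pushR                             ∎

  midswap-natural : midswap ∘ ((f ⊗₁ g) ⊗₁ (h ⊗₁ k)) ≈ ((f ⊗₁ h) ⊗₁ (g ⊗₁ k)) ∘ midswap
  midswap-natural {f = f} {g = g} {h = h} {k = k} = begin
    midswap ∘ ((f ⊗₁ g) ⊗₁ (h ⊗₁ k))                            ≈⟨ ∘-assoc ⟩
    assoc⇐ ∘ ((id ⊗₁ pushR) ∘ assoc⇒) ∘ ((f ⊗₁ g) ⊗₁ (h ⊗₁ k))  ≈⟨ refl⟩∘⟨ ∘-assoc ⟩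
    assoc⇐ ∘ (id ⊗₁ pushR) ∘ assoc⇒ ∘ ((f ⊗₁ g) ⊗₁ (h ⊗₁ k))    ≈⟨ refl⟩∘⟨ refl⟩∘⟨ assoc-natural ⟩
    assoc⇐ ∘ (id ⊗₁ pushR) ∘ (f ⊗₁ (g ⊗₁ (h ⊗₁ k))) ∘ assoc⇒    ≈⟨ refl⟩∘⟨ pullˡ (≈-sym ⊗-∘) ⟩
    assoc⇐ ∘ ((id ∘ f) ⊗₁ (pushR ∘ (g ⊗₁ (h ⊗₁ k)))) ∘ assoc⇒   ≈⟨ refl⟩∘⟨ ⊗-resp-≈ (≈-trans identityˡ (≈-sym identityʳ)) pushR-natural ⟩∘⟨refl ⟩
    assoc⇐ ∘ ((f ∘ id) ⊗₁ ((h ⊗₁ (g ⊗₁ k)) ∘ pushR)) ∘ assoc⇒   ≈⟨ refl⟩∘⟨ ≈-trans (⊗-∘ ⟩∘⟨refl) ∘-assoc ⟩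
    assoc⇐ ∘ (f ⊗₁ (h ⊗₁ (g ⊗₁ k))) ∘ (id ⊗₁ pushR) ∘ assoc⇒    ≈⟨ pullˡ assoc⇐-natural ⟩
    (((f ⊗₁ h) ⊗₁ (g ⊗₁ k)) ∘ assoc⇐) ∘ (id ⊗₁ pushR) ∘ assoc⇒  ≈⟨ ∘-assoc ⟩
    ((f ⊗₁ h) ⊗₁ (g ⊗₁ k)) ∘ midswap                            ∎

  -- The deterministic channels: they form a cartesian category, so equations between
  -- structural maps can be checked on projections, without appeal to coherence.
  record Deterministic {A B : Obj} (d : Hom A B) : Set e where
    constructor deterministic
    field
      copy    : Δ ∘ d ≈ ⟨ d , d ⟩
      discard : ε ∘ d ≈ ε
  open Deterministic public

  ⟨⟩-∘ : Deterministic d → ⟨ f , g ⟩ ∘ d ≈ ⟨ f ∘ d , g ∘ d ⟩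
  ⟨⟩-∘ det = ≈-trans ∘-assoc (≈-trans (refl⟩∘⟨ copy det) ⊗-∘-⟨⟩)

  det-resp-≈ : f ≈ g → Deterministic f → Deterministic g
  det-resp-≈ eq det = deterministic
    (≈-trans (refl⟩∘⟨ ≈-sym eq) (≈-trans (copy det) (⟨⟩-cong eq eq)))
    (≈-trans (refl⟩∘⟨ ≈-sym eq) (discard det))

  det-id : Deterministic (id {A})
  det-id = deterministic (≈-trans identityʳ Δ-⟨⟩) identityʳ

  det-∘ : Deterministic f → Deterministic g → Deterministic (f ∘ g)
  det-∘ df dg = deterministic
    (≈-trans (pullˡ (copy df)) (⟨⟩-∘ dg))
    (≈-trans (pullˡ (discard df)) (discard dg))

  Δ-∘-⟨⟩ : Δ ∘ ⟨ f , g ⟩ ≈ midswap ∘ ⟨ Δ ∘ f , Δ ∘ g ⟩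
  Δ-∘-⟨⟩ = ≈-trans (Δ-⊗ ⟩∘⟨refl) (≈-trans ∘-assoc (refl⟩∘⟨ ⊗-∘-⟨⟩))

  det-⟨⟩ : Deterministic f → Deterministic g → Deterministic ⟨ f , g ⟩
  det-⟨⟩ df dg = deterministic
    (≈-trans Δ-∘-⟨⟩ (≈-trans (refl⟩∘⟨ ⟨⟩-cong (copy df) (copy dg)) midswap-⟨⟩))
    (≈-trans (ε-⊗ ⟩∘⟨refl) (≈-trans ∘-assoc
      (≈-trans (refl⟩∘⟨ ≈-trans ⊗-∘-⟨⟩ (⟨⟩-cong (discard df) (discard dg))) unitˡ-⟨⟩)))

  det-⊗ : Deterministic f → Deterministic g → Deterministic (f ⊗₁ g)
  det-⊗ {f = f} {g = g} df dg = deterministic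
    (begin
      Δ ∘ (f ⊗₁ g)                                  ≈⟨ Δ-⊗ ⟩∘⟨refl ⟩
      (midswap ∘ (Δ ⊗₁ Δ)) ∘ (f ⊗₁ g)               ≈⟨ ∘-assoc ⟩
      midswap ∘ (Δ ⊗₁ Δ) ∘ (f ⊗₁ g)                 ≈⟨ refl⟩∘⟨ ⊗-∘ ⟨
      midswap ∘ ((Δ ∘ f) ⊗₁ (Δ ∘ g))                ≈⟨ refl⟩∘⟨ ⊗-resp-≈ (copy df) (copy dg) ⟩
      midswap ∘ (⟨ f , f ⟩ ⊗₁ ⟨ g , g ⟩)            ≈⟨ refl⟩∘⟨ ⊗-∘ ⟩
      midswap ∘ ((f ⊗₁ f) ⊗₁ (g ⊗₁ g)) ∘ (Δ ⊗₁ Δ)   ≈⟨ pullˡ midswap-natural ⟩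
      (((f ⊗₁ g) ⊗₁ (f ⊗₁ g)) ∘ midswap) ∘ (Δ ⊗₁ Δ) ≈⟨ ∘-assoc ⟩
      ((f ⊗₁ g) ⊗₁ (f ⊗₁ g)) ∘ midswap ∘ (Δ ⊗₁ Δ)   ≈⟨ refl⟩∘⟨ Δ-⊗ ⟨
      ⟨ f ⊗₁ g , f ⊗₁ g ⟩                           ∎)
    (begin
      ε ∘ (f ⊗₁ g)                    ≈⟨ ε-⊗ ⟩∘⟨refl ⟩
      (unitˡ⇒ ∘ (ε ⊗₁ ε)) ∘ (f ⊗₁ g)  ≈⟨ ∘-assoc ⟩
      unitˡ⇒ ∘ (ε ⊗₁ ε) ∘ (f ⊗₁ g)    ≈⟨ refl⟩∘⟨ ⊗-∘ ⟨
      unitˡ⇒ ∘ ((ε ∘ f) ⊗₁ (ε ∘ g))   ≈⟨ refl⟩∘⟨ ⊗-resp-≈ (discard df) (discard dg) ⟩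
      unitˡ⇒ ∘ (ε ⊗₁ ε)               ≈⟨ ε-⊗ ⟨
      ε                               ∎)

  -- Allows each structural isomorphism to be checked in whichever direction is an explicit tuple.
  det-inverse : f ∘ g ≈ id → g ∘ f ≈ id → Deterministic f → Deterministic g
  det-inverse {f = f} {g = g} fg gf det = deterministic
    (begin
      Δ ∘ g                           ≈⟨ cancelˡ (≈-trans (≈-sym ⊗-∘) (⊗-resp-id gf gf)) ⟨
      (g ⊗₁ g) ∘ (f ⊗₁ f) ∘ Δ ∘ g     ≈⟨ refl⟩∘⟨ pullˡ (≈-sym (copy det)) ⟩
      (g ⊗₁ g) ∘ (Δ ∘ f) ∘ g          ≈⟨ refl⟩∘⟨ ≈-trans ∘-assoc (refl⟩∘⟨ fg) ⟩
      (g ⊗₁ g) ∘ Δ ∘ id               ≈⟨ refl⟩∘⟨ identityʳ ⟩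
      ⟨ g , g ⟩                       ∎)
    (≈-trans (≈-sym (discard det) ⟩∘⟨refl) (≈-trans ∘-assoc (≈-trans (refl⟩∘⟨ fg) identityʳ)))

  -- `Δ` on `I` is the invertible `unitˡ⇐`, so it can be cancelled from cocommutativity; no
  -- coherence theorem is invoked.
  σ-I : σ {I} {I} ≈ id
  σ-I = begin
    σ                        ≈⟨ identityʳ ⟨
    σ ∘ id                   ≈⟨ refl⟩∘⟨ unitˡ-iso₂ ⟨
    σ ∘ unitˡ⇐ ∘ unitˡ⇒      ≈⟨ refl⟩∘⟨ ≈-sym Δ-I ⟩∘⟨refl ⟩
    σ ∘ Δ ∘ unitˡ⇒           ≈⟨ pullˡ cocomm ⟩
    Δ ∘ unitˡ⇒               ≈⟨ Δ-I ⟩∘⟨refl ⟩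
    unitˡ⇐ ∘ unitˡ⇒          ≈⟨ unitˡ-iso₂ ⟩
    id                       ∎

  det-ε : Deterministic (ε {A})
  det-ε = deterministic
    (begin
      Δ ∘ ε                   ≈⟨ ≈-trans Δ-I (unitˡ⇐-⟨⟩) ⟩∘⟨refl ⟩
      ⟨ ε , id ⟩ ∘ ε          ≈⟨ ≈-trans (⟨⟩-cong ε-I ≈-refl ⟩∘⟨refl) (≈-trans (≈-sym Δ-⟨⟩ ⟩∘⟨refl) (Δ-I ⟩∘⟨refl)) ⟩
      unitˡ⇐ ∘ ε              ≈⟨ refl⟩∘⟨ unitˡ-⟨⟩ ⟨
      unitˡ⇐ ∘ unitˡ⇒ ∘ ⟨ ε , ε ⟩ ≈⟨ cancelˡ unitˡ-iso₂ ⟩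
      ⟨ ε , ε ⟩               ∎)
    (≈-trans (ε-I ⟩∘⟨refl) identityˡ)

  det-unitˡ⇐ : Deterministic (unitˡ⇐ {A})
  det-unitˡ⇐ = det-resp-≈ (≈-sym unitˡ⇐-⟨⟩) (det-⟨⟩ det-ε det-id)

  det-unitʳ⇐ : Deterministic (unitʳ⇐ {A})
  det-unitʳ⇐ = det-resp-≈ (≈-sym unitʳ⇐-⟨⟩) (det-⟨⟩ det-id det-ε)

  det-unitˡ⇒ : Deterministic (unitˡ⇒ {A})
  det-unitˡ⇒ = det-inverse unitˡ-iso₂ unitˡ-iso₁ det-unitˡ⇐

  det-unitʳ⇒ : Deterministic (unitʳ⇒ {A})
  det-unitʳ⇒ = det-inverse unitʳ-iso₂ unitʳ-iso₁ det-unitʳ⇐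

  π₁ : Hom (A ⊗₀ B) A
  π₁ = unitʳ⇒ ∘ (id ⊗₁ ε)

  π₂ : Hom (A ⊗₀ B) B
  π₂ = unitˡ⇒ ∘ (ε ⊗₁ id)

  det-π₁ : Deterministic (π₁ {A} {B})
  det-π₁ = det-∘ det-unitʳ⇒ (det-⊗ det-id det-ε)

  det-π₂ : Deterministic (π₂ {A} {B})
  det-π₂ = det-∘ det-unitˡ⇒ (det-⊗ det-ε det-id)

  π₁-⟨⟩-any : π₁ ∘ ⟨ f , g ⟩ ≈ unitʳ⇒ ∘ ⟨ f , ε ∘ g ⟩
  π₁-⟨⟩-any = ≈-trans ∘-assoc (refl⟩∘⟨ ≈-trans ⊗-∘-⟨⟩ (⟨⟩-cong identityˡ ≈-refl))

  π₂-⟨⟩-any : π₂ ∘ ⟨ f , g ⟩ ≈ unitˡ⇒ ∘ ⟨ ε ∘ f , g ⟩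
  π₂-⟨⟩-any = ≈-trans ∘-assoc (refl⟩∘⟨ ≈-trans ⊗-∘-⟨⟩ (⟨⟩-cong ≈-refl identityˡ))

  π₁-⟨⟩ : IsChannel g → π₁ ∘ ⟨ f , g ⟩ ≈ f
  π₁-⟨⟩ ch = ≈-trans π₁-⟨⟩-any (≈-trans (refl⟩∘⟨ ⟨⟩-cong ≈-refl ch) unitʳ-⟨⟩)

  π₂-⟨⟩ : IsChannel f → π₂ ∘ ⟨ f , g ⟩ ≈ g
  π₂-⟨⟩ ch = ≈-trans π₂-⟨⟩-any (≈-trans (refl⟩∘⟨ ⟨⟩-cong ch ≈-refl) unitˡ-⟨⟩)

  pushR-I : pushR {I} {I} {B} ≈ id
  pushR-I = ≈-trans (refl⟩∘⟨ ≈-trans (⊗-resp-id σ-I ≈-refl ⟩∘⟨refl) identityˡ) assoc-iso₁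

  midswap-I : midswap {A} {I} {I} {B} ≈ id
  midswap-I = begin
    assoc⇐ ∘ (id ⊗₁ pushR) ∘ assoc⇒  ≈⟨ refl⟩∘⟨ ≈-trans (⊗-resp-id ≈-refl pushR-I ⟩∘⟨refl) identityˡ ⟩
    assoc⇐ ∘ assoc⇒                  ≈⟨ assoc-iso₂ ⟩
    id                               ∎

  -- In `Δ-⊗` the two inner copies are discarded. The interchange then only swaps two units, which
  -- is trivial by `σ-I`, and the counit laws remain.
  ⟨π₁,π₂⟩ : ⟨ π₁ , π₂ ⟩ ≈ id {A ⊗₀ B}
  ⟨π₁,π₂⟩ = begin
    (π₁ ⊗₁ π₂) ∘ Δ                                                      ≈⟨ ≈-trans (⊗-∘ ⟩∘⟨refl) ∘-assoc ⟩
    (unitʳ⇒ ⊗₁ unitˡ⇒) ∘ ((id ⊗₁ ε) ⊗₁ (ε ⊗₁ id)) ∘ Δ                   ≈⟨ refl⟩∘⟨ refl⟩∘⟨ Δ-⊗ ⟩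
    (unitʳ⇒ ⊗₁ unitˡ⇒) ∘ ((id ⊗₁ ε) ⊗₁ (ε ⊗₁ id)) ∘ midswap ∘ (Δ ⊗₁ Δ)  ≈⟨ refl⟩∘⟨ pullˡ (≈-sym midswap-natural) ⟩
    (unitʳ⇒ ⊗₁ unitˡ⇒) ∘ (midswap ∘ ((id ⊗₁ ε) ⊗₁ (ε ⊗₁ id))) ∘ (Δ ⊗₁ Δ)
      ≈⟨ refl⟩∘⟨ ≈-trans (midswap-I ⟩∘⟨refl) identityˡ ⟩∘⟨refl ⟩
    (unitʳ⇒ ⊗₁ unitˡ⇒) ∘ ((id ⊗₁ ε) ⊗₁ (ε ⊗₁ id)) ∘ (Δ ⊗₁ Δ)            ≈⟨ refl⟩∘⟨ ⊗-∘ ⟨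
    (unitʳ⇒ ⊗₁ unitˡ⇒) ∘ (⟨ id , ε ⟩ ⊗₁ ⟨ ε , id ⟩)                     ≈⟨ ⊗-∘ ⟨
    (unitʳ⇒ ∘ ⟨ id , ε ⟩) ⊗₁ (unitˡ⇒ ∘ ⟨ ε , id ⟩)                      ≈⟨ ⊗-resp-id counitʳ counitˡ ⟩
    id                                                                  ∎

  ⟨⟩-η : Deterministic d → ⟨ π₁ ∘ d , π₂ ∘ d ⟩ ≈ d
  ⟨⟩-η det = ≈-trans (≈-sym (⟨⟩-∘ det)) (≈-trans (⟨π₁,π₂⟩ ⟩∘⟨refl) identityˡ)

  ⊗-⟨⟩ : f ⊗₁ g ≈ ⟨ f ∘ π₁ , g ∘ π₂ ⟩
  ⊗-⟨⟩ = ≈-trans (≈-sym identityʳ) (≈-trans (refl⟩∘⟨ ≈-sym ⟨π₁,π₂⟩) ⊗-∘-⟨⟩)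

  -- Surjective pairing presents the identity as a tuple of projections, on which `assoc-⟨⟩`
  -- computes. Determinism of the associator is read off from the result.
  assoc⇒-⟨⟩ : assoc⇒ {A} {B} {X} ≈ ⟨ π₁ ∘ π₁ , ⟨ π₂ ∘ π₁ , π₂ ⟩ ⟩
  assoc⇒-⟨⟩ = begin
    assoc⇒                                    ≈⟨ identityʳ ⟨
    assoc⇒ ∘ id                               ≈⟨ refl⟩∘⟨ ⟨π₁,π₂⟩ ⟨
    assoc⇒ ∘ ⟨ π₁ , π₂ ⟩                      ≈⟨ refl⟩∘⟨ ⟨⟩-cong (⟨⟩-η det-π₁) ≈-refl ⟨
    assoc⇒ ∘ ⟨ ⟨ π₁ ∘ π₁ , π₂ ∘ π₁ ⟩ , π₂ ⟩   ≈⟨ assoc-⟨⟩ ⟩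
    ⟨ π₁ ∘ π₁ , ⟨ π₂ ∘ π₁ , π₂ ⟩ ⟩            ∎

  det-assoc⇒ : Deterministic (assoc⇒ {A} {B} {X})
  det-assoc⇒ = det-resp-≈ (≈-sym assoc⇒-⟨⟩)
    (det-⟨⟩ (det-∘ det-π₁ det-π₁) (det-⟨⟩ (det-∘ det-π₂ det-π₁) det-π₂))

  ε-unique : {f : Hom A I} → IsChannel f → f ≈ ε
  ε-unique ch = ≈-trans (≈-sym identityˡ) (≈-trans (≈-sym ε-I ⟩∘⟨refl) ch)

  unitˡ⇒-π₂ : unitˡ⇒ ≈ π₂ {I} {A}
  unitˡ⇒-π₂ = ≈-trans (≈-sym identityʳ) (refl⟩∘⟨ ≈-sym (⊗-resp-id ε-I ≈-refl))

  unitʳ⇒-π₁ : unitʳ⇒ ≈ π₁ {A} {I}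
  unitʳ⇒-π₁ = ≈-trans (≈-sym identityʳ) (refl⟩∘⟨ ≈-sym (⊗-resp-id ≈-refl ε-I))

-- Effects acting as weights.

module EffectAction {o ℓ e : Level} (C : CDCat o ℓ e) where
  open CDCat C
  open CopyDiscard C
  open HomReasoning

  private variable
    A B X Y : Obj
    a b u v : Hom A I
    f g h k d : Hom A B

  infixr 8 _·_

  -- Pointwise reweighting of `f` by the likelihood `a` on a copy of the input. Cap comparisons and
  -- the masses `ε ∘ f` all enter in this form.
  _·_ : Hom A I → Hom A B → Hom A B
  a · f = unitˡ⇒ ∘ ⟨ a , f ⟩

  ·-cong : a ≈ b → f ≈ g → a · f ≈ b · g
  ·-cong p q = refl⟩∘⟨ ⟨⟩-cong p q

  ∘-· : k ∘ (a · f) ≈ a · (k ∘ f)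
  ∘-· {k = k} {a = a} {f = f} = begin
    k ∘ unitˡ⇒ ∘ ⟨ a , f ⟩             ≈⟨ pullˡ (≈-sym unitˡ-natural) ⟩
    (unitˡ⇒ ∘ (id ⊗₁ k)) ∘ ⟨ a , f ⟩   ≈⟨ ∘-assoc ⟩
    unitˡ⇒ ∘ (id ⊗₁ k) ∘ ⟨ a , f ⟩     ≈⟨ refl⟩∘⟨ ≈-trans ⊗-∘-⟨⟩ (⟨⟩-cong identityˡ ≈-refl) ⟩
    a · (k ∘ f)                        ∎

  -- Unlike postcomposition, this needs determinism, because the action copies its input.
  ·-∘ : Deterministic d → (a · f) ∘ d ≈ (a ∘ d) · (f ∘ d)
  ·-∘ det = ≈-trans ∘-assoc (refl⟩∘⟨ ⟨⟩-∘ det)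

  -- An instance of monoidal coherence, here verified on projections.
  unitˡ⇒-assoc⇒ : unitˡ⇒ ∘ assoc⇒ ≈ unitˡ⇒ {A} ⊗₁ id {B}
  unitˡ⇒-assoc⇒ = begin
    unitˡ⇒ ∘ assoc⇒                                  ≈⟨ ∘-resp-≈ unitˡ⇒-π₂ assoc⇒-⟨⟩ ⟩
    π₂ ∘ ⟨ π₁ ∘ π₁ , ⟨ π₂ ∘ π₁ , π₂ ⟩ ⟩              ≈⟨ π₂-⟨⟩ (discard (det-∘ det-π₁ det-π₁)) ⟩
    ⟨ π₂ ∘ π₁ , π₂ ⟩                                 ≈⟨ ⟨⟩-cong (≈-sym unitˡ⇒-π₂ ⟩∘⟨refl) (≈-sym identityˡ) ⟩
    ⟨ unitˡ⇒ ∘ π₁ , id ∘ π₂ ⟩                        ≈⟨ ⊗-⟨⟩ ⟨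
    unitˡ⇒ ⊗₁ id                                     ∎

  ⟨·,⟩ : ⟨ a · f , g ⟩ ≈ a · ⟨ f , g ⟩
  ⟨·,⟩ {a = a} {f = f} {g = g} = begin
    ⟨ unitˡ⇒ ∘ ⟨ a , f ⟩ , g ⟩             ≈⟨ ⟨⟩-cong ≈-refl identityˡ ⟨
    ⟨ unitˡ⇒ ∘ ⟨ a , f ⟩ , id ∘ g ⟩        ≈⟨ ⊗-∘-⟨⟩ ⟨
    (unitˡ⇒ ⊗₁ id) ∘ ⟨ ⟨ a , f ⟩ , g ⟩     ≈⟨ unitˡ⇒-assoc⇒ ⟩∘⟨refl ⟨
    (unitˡ⇒ ∘ assoc⇒) ∘ ⟨ ⟨ a , f ⟩ , g ⟩  ≈⟨ ≈-trans ∘-assoc (refl⟩∘⟨ assoc-⟨⟩) ⟩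
    a · ⟨ f , g ⟩                          ∎

  ⟨,·⟩ : ⟨ f , a · g ⟩ ≈ a · ⟨ f , g ⟩
  ⟨,·⟩ = ≈-trans (≈-sym σ-⟨⟩) (≈-trans (refl⟩∘⟨ ⟨·,⟩) (≈-trans ∘-· (·-cong ≈-refl σ-⟨⟩)))

  ·-assoc : a · b · f ≈ (a · b) · f
  ·-assoc = ≈-sym (≈-trans (refl⟩∘⟨ ⟨·,⟩) ∘-·)

  -- Swapping two scalar outputs is invisible since `σ` is the identity on `I ⊗₀ I`.
  ·-comm : a · b ≈ b · a
  ·-comm = refl⟩∘⟨ ≈-trans (≈-sym σ-⟨⟩) (≈-trans (σ-I ⟩∘⟨refl) identityˡ)

  ·-swap : a · b · f ≈ b · a · f
  ·-swap = ≈-trans ·-assoc (≈-trans (·-cong ·-comm ≈-refl) (≈-sym ·-assoc))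

  σ-π : σ {A} {B} ≈ ⟨ π₂ , π₁ ⟩
  σ-π = ≈-trans (≈-sym identityʳ) (≈-trans (refl⟩∘⟨ ≈-sym ⟨π₁,π₂⟩) σ-⟨⟩)

  unitʳ-· : unitʳ⇒ ∘ ⟨ f , a ⟩ ≈ a · f
  unitʳ-· {f = f} {a = a} = begin
    unitʳ⇒ ∘ ⟨ f , a ⟩               ≈⟨ unitʳ⇒-π₁ ⟩∘⟨refl ⟩
    π₁ ∘ ⟨ f , a ⟩                   ≈⟨ ≈-sym (π₂-⟨⟩ (discard det-π₂)) ⟩∘⟨refl ⟩
    (π₂ ∘ ⟨ π₂ , π₁ ⟩) ∘ ⟨ f , a ⟩   ≈⟨ ∘-resp-≈ unitˡ⇒-π₂ σ-π ⟩∘⟨refl ⟨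
    (unitˡ⇒ ∘ σ) ∘ ⟨ f , a ⟩         ≈⟨ ≈-trans ∘-assoc (refl⟩∘⟨ σ-⟨⟩) ⟩
    a · f                            ∎

  -- Discarding a component that is not a channel leaves its mass behind as a weight; this is what
  -- `norm-marginals` has to undo.
  π₁-· : π₁ ∘ ⟨ f , g ⟩ ≈ (ε ∘ g) · f
  π₁-· = ≈-trans π₁-⟨⟩-any unitʳ-·

-- Caps as comparisons, and normalisation of products.

module Caps {o ℓ e : Level} {C : CDCat o ℓ e} (EC : EffectConditioning C) where
  open CDCat C
  open EffectConditioning EC
  open CopyDiscard C
  open HomReasoning
  open EffectAction C

  private variable
    A B X Y V Θ : Obj
    f g h k d : Hom A B

  capApply-cong : {f g : Hom A (B ⊗₀ X)} → f ≈ g → capApply f ≈ capApply g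
  capApply-cong eq = refl⟩∘⟨ refl⟩∘⟨ refl⟩∘⟨ ⊗-resp-≈ eq ≈-refl

  -- Bending down the output `g` turns it into a likelihood: its comparison with the new input `π₂`,
  -- acting on `f`. The map `s`, later a state, stays outside because it need not be copyable.
  capApply-⟨⟩ : {f : Hom Θ B} {g : Hom Θ X} {s : Hom A Θ} →
                capApply (⟨ f , g ⟩ ∘ s)
                ≈ ((cap ∘ ⟨ g ∘ π₁ , π₂ ⟩) · (f ∘ π₁)) ∘ (s ⊗₁ id)
  capApply-⟨⟩ {f = f} {g = g} {s = s} = begin
    unitʳ⇒ ∘ (id ⊗₁ cap) ∘ assoc⇒ ∘ ((⟨ f , g ⟩ ∘ s) ⊗₁ id)
      ≈⟨ refl⟩∘⟨ refl⟩∘⟨ refl⟩∘⟨ ⊗-resp-≈ ≈-refl (≈-sym identityˡ) ⟩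
    unitʳ⇒ ∘ (id ⊗₁ cap) ∘ assoc⇒ ∘ ((⟨ f , g ⟩ ∘ s) ⊗₁ (id ∘ id))
      ≈⟨ refl⟩∘⟨ refl⟩∘⟨ refl⟩∘⟨ ⊗-∘ ⟩
    unitʳ⇒ ∘ (id ⊗₁ cap) ∘ assoc⇒ ∘ (⟨ f , g ⟩ ⊗₁ id) ∘ (s ⊗₁ id)
      ≈⟨ refl⟩∘⟨ refl⟩∘⟨ refl⟩∘⟨ ≈-trans ⊗-⟨⟩ (⟨⟩-cong (⟨⟩-∘ det-π₁) identityˡ) ⟩∘⟨refl ⟩
    unitʳ⇒ ∘ (id ⊗₁ cap) ∘ assoc⇒ ∘ ⟨ ⟨ f ∘ π₁ , g ∘ π₁ ⟩ , π₂ ⟩ ∘ (s ⊗₁ id)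
      ≈⟨ refl⟩∘⟨ refl⟩∘⟨ pullˡ assoc-⟨⟩ ⟩
    unitʳ⇒ ∘ (id ⊗₁ cap) ∘ ⟨ f ∘ π₁ , ⟨ g ∘ π₁ , π₂ ⟩ ⟩ ∘ (s ⊗₁ id)
      ≈⟨ refl⟩∘⟨ pullˡ (≈-trans ⊗-∘-⟨⟩ (⟨⟩-cong identityˡ ≈-refl)) ⟩
    unitʳ⇒ ∘ ⟨ f ∘ π₁ , cap ∘ ⟨ g ∘ π₁ , π₂ ⟩ ⟩ ∘ (s ⊗₁ id)
      ≈⟨ pullˡ unitʳ-· ⟩
    ((cap ∘ ⟨ g ∘ π₁ , π₂ ⟩) · (f ∘ π₁)) ∘ (s ⊗₁ id) ∎

  cap-⟨⟩ : {f h : Hom A X} {g k : Hom A Y} →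
           cap ∘ ⟨ ⟨ f , g ⟩ , ⟨ h , k ⟩ ⟩ ≈ (cap ∘ ⟨ f , h ⟩) · (cap ∘ ⟨ g , k ⟩)
  cap-⟨⟩ {f = f} {h = h} {g = g} {k = k} = begin
    cap ∘ ⟨ ⟨ f , g ⟩ , ⟨ h , k ⟩ ⟩                                ≈⟨ cap-⊗ ⟩∘⟨refl ⟩
    (unitˡ⇒ ∘ (cap ⊗₁ cap) ∘ midswap) ∘ ⟨ ⟨ f , g ⟩ , ⟨ h , k ⟩ ⟩  ≈⟨ ≈-trans ∘-assoc (refl⟩∘⟨ ∘-assoc) ⟩
    unitˡ⇒ ∘ (cap ⊗₁ cap) ∘ midswap ∘ ⟨ ⟨ f , g ⟩ , ⟨ h , k ⟩ ⟩    ≈⟨ refl⟩∘⟨ refl⟩∘⟨ midswap-⟨⟩ ⟩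
    unitˡ⇒ ∘ (cap ⊗₁ cap) ∘ ⟨ ⟨ f , h ⟩ , ⟨ g , k ⟩ ⟩              ≈⟨ refl⟩∘⟨ ⊗-∘-⟨⟩ ⟩
    (cap ∘ ⟨ f , h ⟩) · (cap ∘ ⟨ g , k ⟩)                          ∎

  -- The snake equation moves the surviving copy from one leg of the cap to the other. Both maps
  -- must be copyable, as one copy is compared and the other returned.
  cap-transport : Deterministic f → Deterministic g →
                  (cap ∘ ⟨ f , g ⟩) · f ≈ (cap ∘ ⟨ f , g ⟩) · g
  cap-transport {f = f} {g = g} df dg = begin
    (cap ∘ ⟨ f , g ⟩) · f                                         ≈⟨ unitʳ-· ⟨
    unitʳ⇒ ∘ ⟨ f , cap ∘ ⟨ f , g ⟩ ⟩                              ≈⟨ refl⟩∘⟨ ⟨⟩-cong identityˡ ≈-refl ⟨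
    unitʳ⇒ ∘ ⟨ id ∘ f , cap ∘ ⟨ f , g ⟩ ⟩                         ≈⟨ refl⟩∘⟨ ⊗-∘-⟨⟩ ⟨
    unitʳ⇒ ∘ (id ⊗₁ cap) ∘ ⟨ f , ⟨ f , g ⟩ ⟩                      ≈⟨ refl⟩∘⟨ refl⟩∘⟨ assoc-⟨⟩ ⟨
    unitʳ⇒ ∘ (id ⊗₁ cap) ∘ assoc⇒ ∘ ⟨ ⟨ f , f ⟩ , g ⟩             ≈⟨ refl⟩∘⟨ refl⟩∘⟨ refl⟩∘⟨ ⟨⟩-cong (copy df) identityˡ ⟨
    unitʳ⇒ ∘ (id ⊗₁ cap) ∘ assoc⇒ ∘ ⟨ Δ ∘ f , id ∘ g ⟩            ≈⟨ refl⟩∘⟨ refl⟩∘⟨ refl⟩∘⟨ ⊗-∘-⟨⟩ ⟨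
    unitʳ⇒ ∘ (id ⊗₁ cap) ∘ assoc⇒ ∘ (Δ ⊗₁ id) ∘ ⟨ f , g ⟩         ≈⟨ fold ⟨
    (unitʳ⇒ ∘ (id ⊗₁ cap) ∘ assoc⇒ ∘ (Δ ⊗₁ id)) ∘ ⟨ f , g ⟩       ≈⟨ cap-snake ⟩∘⟨refl ⟨
    (unitˡ⇒ ∘ (cap ⊗₁ id) ∘ assoc⇐ ∘ (id ⊗₁ Δ)) ∘ ⟨ f , g ⟩       ≈⟨ fold ⟩
    unitˡ⇒ ∘ (cap ⊗₁ id) ∘ assoc⇐ ∘ (id ⊗₁ Δ) ∘ ⟨ f , g ⟩         ≈⟨ refl⟩∘⟨ refl⟩∘⟨ refl⟩∘⟨ ⊗-∘-⟨⟩ ⟩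
    unitˡ⇒ ∘ (cap ⊗₁ id) ∘ assoc⇐ ∘ ⟨ id ∘ f , Δ ∘ g ⟩            ≈⟨ refl⟩∘⟨ refl⟩∘⟨ refl⟩∘⟨ ⟨⟩-cong identityˡ (copy dg) ⟩
    unitˡ⇒ ∘ (cap ⊗₁ id) ∘ assoc⇐ ∘ ⟨ f , ⟨ g , g ⟩ ⟩             ≈⟨ refl⟩∘⟨ refl⟩∘⟨ assoc⇐-⟨⟩ ⟩
    unitˡ⇒ ∘ (cap ⊗₁ id) ∘ ⟨ ⟨ f , g ⟩ , g ⟩                      ≈⟨ refl⟩∘⟨ ≈-trans ⊗-∘-⟨⟩ (⟨⟩-cong ≈-refl identityˡ) ⟩
    (cap ∘ ⟨ f , g ⟩) · g                                         ∎
    where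
    fold : ∀ {A B X Y Z W : Obj} {p : Hom Z W} {q : Hom Y Z} {r : Hom X Y} {s : Hom B X} {x : Hom A B} →
           (p ∘ q ∘ r ∘ s) ∘ x ≈ p ∘ q ∘ r ∘ s ∘ x
    fold = ≈-trans ∘-assoc (refl⟩∘⟨ ≈-trans ∘-assoc (refl⟩∘⟨ ∘-assoc))

  -- Writing the input of `f` as `⟨ π₁ , π₂ ⟩`, the weight slides through `f` onto the first
  -- component, where `cap-transport` applies, and slides back.
  cap-subst : {f : Hom (V ⊗₀ Θ) B} {γ : Hom Θ V} → Deterministic γ →
              (cap ∘ ⟨ π₁ , γ ∘ π₂ ⟩) · f ≈ (cap ∘ ⟨ π₁ , γ ∘ π₂ ⟩) · (f ∘ ⟨ γ , id ⟩ ∘ π₂)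
  cap-subst {f = f} {γ = γ} dγ = begin
    a · f                                ≈⟨ ·-cong ≈-refl identityʳ ⟨
    a · (f ∘ id)                         ≈⟨ ·-cong ≈-refl (refl⟩∘⟨ ⟨π₁,π₂⟩) ⟨
    a · (f ∘ ⟨ π₁ , π₂ ⟩)                ≈⟨ ∘-· ⟨
    f ∘ (a · ⟨ π₁ , π₂ ⟩)                ≈⟨ refl⟩∘⟨ ⟨·,⟩ ⟨
    f ∘ ⟨ a · π₁ , π₂ ⟩                  ≈⟨ refl⟩∘⟨ ⟨⟩-cong (cap-transport det-π₁ (det-∘ dγ det-π₂)) ≈-refl ⟩
    f ∘ ⟨ a · (γ ∘ π₂) , π₂ ⟩            ≈⟨ refl⟩∘⟨ ⟨·,⟩ ⟩
    f ∘ (a · ⟨ γ ∘ π₂ , π₂ ⟩)            ≈⟨ ∘-· ⟩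
    a · (f ∘ ⟨ γ ∘ π₂ , π₂ ⟩)            ≈⟨ ·-cong ≈-refl (refl⟩∘⟨ ≈-trans (⟨⟩-∘ det-π₂) (⟨⟩-cong ≈-refl identityˡ)) ⟨
    a · (f ∘ ⟨ γ , id ⟩ ∘ π₂)            ∎
    where a = cap ∘ ⟨ π₁ , γ ∘ π₂ ⟩

  norm-⟨⟩ : norm ⟨ f , g ⟩ ≈ ⟨ norm f , norm g ⟩
  norm-⟨⟩ {f = f} {g = g} = ≈-trans (norm-Δ (f ⊗₁ g)) (norm-⊗ f g ⟩∘⟨refl)

  norm-decompose : (f : Hom A B) → f ≈ (ε ∘ f) · norm f
  norm-decompose f = ≈-trans (norm-eq f) unitʳ-·

  norm-idempotent : (f : Hom A B) → norm f ≈ (ε ∘ norm f) · norm f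
  norm-idempotent f = ≈-trans (norm-partial f) unitʳ-·

  -- norm is not assumed to commute with unitors; this follows because unitˡ⇐ ∘ f is the
  -- pair ⟨ ε ∘ f , norm f ⟩, on which norm acts componentwise.
  norm-unitˡ⇒ : (k : Hom A (I ⊗₀ B)) → norm (unitˡ⇒ ∘ k) ≈ unitˡ⇒ ∘ norm k
  norm-unitˡ⇒ k = ≈-sym (begin
    unitˡ⇒ ∘ norm k                          ≈⟨ refl⟩∘⟨ norm-resp-≈ k≈ ⟩
    unitˡ⇒ ∘ norm ⟨ ε ∘ l , norm l ⟩         ≈⟨ refl⟩∘⟨ norm-⟨⟩ ⟩
    norm (ε ∘ l) · norm (norm l)             ≈⟨ ·-cong (norm-ε l) (norm-id (norm l) (norm-partial l)) ⟩
    (ε ∘ norm l) · norm l                    ≈⟨ norm-idempotent l ⟨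
    norm l                                   ∎)
    where
    l = unitˡ⇒ ∘ k
    k≈ : k ≈ ⟨ ε ∘ l , norm l ⟩
    k≈ = begin
      k                                   ≈⟨ cancelˡ unitˡ-iso₂ ⟨
      unitˡ⇐ ∘ l                          ≈⟨ refl⟩∘⟨ norm-decompose l ⟩
      unitˡ⇐ ∘ ((ε ∘ l) · norm l)           ≈⟨ cancelˡ unitˡ-iso₂ ⟩
      ⟨ ε ∘ l , norm l ⟩                  ∎

  norm-· : {a : Hom A I} {f : Hom A B} → norm (a · f) ≈ norm a · norm f
  norm-· = ≈-trans (norm-unitˡ⇒ _) (refl⟩∘⟨ norm-⟨⟩)

  -- By `π₁-·` the first normalised marginal is `(ε ∘ norm g) · norm f`, and symmetrically for the
  -- second. Since `norm f` absorbs its own weight `ε ∘ norm f`, and weights move freely between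
  -- components of a pair, each component can be given the weight of the other.
  norm-marginals : {f : Hom A X} {g : Hom A Y} → h ≈ ⟨ f , g ⟩ →
                   norm h ≈ ⟨ norm (π₁ ∘ h) , norm (π₂ ∘ h) ⟩
  norm-marginals {h = h} {f = f} {g = g} eq = begin
    norm h                                                          ≈⟨ ≈-trans (norm-resp-≈ eq) norm-⟨⟩ ⟩
    ⟨ norm f , norm g ⟩                                             ≈⟨ ⟨⟩-cong (norm-idempotent f) (norm-idempotent g) ⟩
    ⟨ (ε ∘ norm f) · norm f , (ε ∘ norm g) · norm g ⟩               ≈⟨ ⟨·,⟩ ⟩
    (ε ∘ norm f) · ⟨ norm f , (ε ∘ norm g) · norm g ⟩               ≈⟨ ·-cong ≈-refl (≈-trans ⟨,·⟩ (≈-sym ⟨·,⟩)) ⟩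
    (ε ∘ norm f) · ⟨ (ε ∘ norm g) · norm f , norm g ⟩               ≈⟨ ⟨,·⟩ ⟨
    ⟨ (ε ∘ norm g) · norm f , (ε ∘ norm f) · norm g ⟩               ≈⟨ ⟨⟩-cong (component g f) (component f g) ⟨
    ⟨ norm ((ε ∘ g) · f) , norm ((ε ∘ f) · g) ⟩                     ≈⟨ ⟨⟩-cong (norm-resp-≈ π₁-·) (norm-resp-≈ π₂-⟨⟩-any) ⟨
    ⟨ norm (π₁ ∘ ⟨ f , g ⟩) , norm (π₂ ∘ ⟨ f , g ⟩) ⟩               ≈⟨ ⟨⟩-cong (norm-resp-≈ (refl⟩∘⟨ eq)) (norm-resp-≈ (refl⟩∘⟨ eq)) ⟨
    ⟨ norm (π₁ ∘ h) , norm (π₂ ∘ h) ⟩                               ∎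
    where
    component : ∀ {X Y} (u : Hom _ X) (v : Hom _ Y) → norm ((ε ∘ u) · v) ≈ (ε ∘ norm u) · norm v
    component u v = ≈-trans norm-· (·-cong (norm-ε u) ≈-refl)

-- Binding an extra variable: ext h runs the kernel h and adds its output to the context.
module Extension {o ℓ e : Level} {C : CDCat o ℓ e} (EC : EffectConditioning C)
                 {V Θ Θ′ : CDCat.Obj C} (J : CDCat.Hom C (CDCat._⊗₀_ C V Θ) Θ′)
                 (K : CDCat.Hom C Θ′ (CDCat._⊗₀_ C V Θ))
                 (JK : CDCat._≈_ C (CDCat._∘_ C J K) (CDCat.id C))
                 (KJ : CDCat._≈_ C (CDCat._∘_ C K J) (CDCat.id C))
                 (det-K : CopyDiscard.Deterministic C K) where
  open CDCat C
  open EffectConditioning EC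
  open CopyDiscard C
  open HomReasoning
  open EffectAction C
  open Caps EC

  private variable
    B D : Obj

  ext : Hom Θ V → Hom Θ Θ′
  ext h = J ∘ ⟨ h , id ⟩

  hd : Hom Θ′ V
  hd = π₁ ∘ K

  tl : Hom Θ′ Θ
  tl = π₂ ∘ K

  det-tl : Deterministic tl
  det-tl = det-∘ det-π₂ det-K

  det-ext : {γ : Hom Θ V} → Deterministic γ → Deterministic (ext γ)
  det-ext dγ = det-∘ (det-inverse KJ JK det-K) (det-⟨⟩ dγ det-id)

  -- The kernel `h` may be random: its output is used in one component only, so it is run once and
  -- need not be copied.
  weaken-⟨⟩ : {h : Hom Θ V} {p : Hom (V ⊗₀ Θ) B} {q : Hom Θ D} →
              ⟨ p , q ∘ π₂ ⟩ ∘ ⟨ h , id ⟩ ≈ ⟨ p ∘ ⟨ h , id ⟩ , q ⟩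
  weaken-⟨⟩ {h = h} {p} {q} = begin
    ⟨ p , q ∘ π₂ ⟩ ∘ ⟨ h , id ⟩                               ≈⟨ ≈-trans ⊗-∘-⟨⟩ (⟨⟩-cong identityʳ ≈-refl) ⟩∘⟨refl ⟨
    ((p ⊗₁ q) ∘ ⟨ id , π₂ ⟩) ∘ ⟨ h , id ⟩                     ≈⟨ ≈-trans ∘-assoc (refl⟩∘⟨ duplicate ⟩∘⟨refl) ⟩
    (p ⊗₁ q) ∘ (assoc⇐ ∘ (id ⊗₁ Δ)) ∘ ⟨ h , id ⟩              ≈⟨ refl⟩∘⟨ ≈-trans ∘-assoc (refl⟩∘⟨ ⊗-∘-⟨⟩) ⟩
    (p ⊗₁ q) ∘ assoc⇐ ∘ ⟨ id ∘ h , Δ ∘ id ⟩                   ≈⟨ refl⟩∘⟨ refl⟩∘⟨ ⟨⟩-cong identityˡ (≈-trans identityʳ Δ-⟨⟩) ⟩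
    (p ⊗₁ q) ∘ assoc⇐ ∘ ⟨ h , ⟨ id , id ⟩ ⟩                   ≈⟨ refl⟩∘⟨ assoc⇐-⟨⟩ ⟩
    (p ⊗₁ q) ∘ ⟨ ⟨ h , id ⟩ , id ⟩                            ≈⟨ ≈-trans ⊗-∘-⟨⟩ (⟨⟩-cong ≈-refl identityʳ) ⟩
    ⟨ p ∘ ⟨ h , id ⟩ , q ⟩                                    ∎
    where
    duplicate : ⟨ id , π₂ ⟩ ≈ assoc⇐ ∘ (id {V} ⊗₁ Δ {Θ})
    duplicate = begin
      ⟨ id , π₂ ⟩                     ≈⟨ ⟨⟩-cong ⟨π₁,π₂⟩ ≈-refl ⟨
      ⟨ ⟨ π₁ , π₂ ⟩ , π₂ ⟩            ≈⟨ assoc⇐-⟨⟩ ⟨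
      assoc⇐ ∘ ⟨ π₁ , ⟨ π₂ , π₂ ⟩ ⟩   ≈⟨ refl⟩∘⟨ ⟨⟩-cong identityˡ (copy det-π₂) ⟨
      assoc⇐ ∘ ⟨ id ∘ π₁ , Δ ∘ π₂ ⟩   ≈⟨ refl⟩∘⟨ ⊗-⟨⟩ ⟨
      assoc⇐ ∘ (id ⊗₁ Δ)              ∎

  ext-⟨⟩ʳ : {h : Hom Θ V} {p : Hom Θ′ B} {q : Hom Θ D} →
            ⟨ p , q ∘ tl ⟩ ∘ ext h ≈ ⟨ p ∘ ext h , q ⟩
  ext-⟨⟩ʳ {h = h} {p} {q} = begin
    ⟨ p , q ∘ tl ⟩ ∘ J ∘ ⟨ h , id ⟩                  ≈⟨ pullˡ (⟨⟩-∘ (det-inverse KJ JK det-K)) ⟩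
    ⟨ p ∘ J , (q ∘ tl) ∘ J ⟩ ∘ ⟨ h , id ⟩            ≈⟨ ⟨⟩-cong ≈-refl tl-J ⟩∘⟨refl ⟩
    ⟨ p ∘ J , q ∘ π₂ ⟩ ∘ ⟨ h , id ⟩                  ≈⟨ weaken-⟨⟩ ⟩
    ⟨ (p ∘ J) ∘ ⟨ h , id ⟩ , q ⟩                     ≈⟨ ⟨⟩-cong ∘-assoc ≈-refl ⟩
    ⟨ p ∘ ext h , q ⟩                                ∎
    where
    tl-J : (q ∘ tl) ∘ J ≈ q ∘ π₂
    tl-J = ≈-trans ∘-assoc (refl⟩∘⟨ ≈-trans ∘-assoc (≈-trans (refl⟩∘⟨ KJ) identityʳ))

  ext-⟨⟩ˡ : {h : Hom Θ V} {p : Hom Θ′ B} {q : Hom Θ D} →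
            ⟨ q ∘ tl , p ⟩ ∘ ext h ≈ ⟨ q , p ∘ ext h ⟩
  ext-⟨⟩ˡ = ≈-trans (≈-sym σ-⟨⟩ ⟩∘⟨refl)
    (≈-trans ∘-assoc (≈-trans (refl⟩∘⟨ ext-⟨⟩ʳ) σ-⟨⟩))

  ext-·ˡ : {h : Hom Θ V} {a : Hom Θ I} {p : Hom Θ′ B} → ((a ∘ tl) · p) ∘ ext h ≈ a · (p ∘ ext h)
  ext-·ˡ = ≈-trans ∘-assoc (refl⟩∘⟨ ext-⟨⟩ˡ)

  ext-·ʳ : {h : Hom Θ V} {a : Hom Θ′ I} {q : Hom Θ B} → (a · (q ∘ tl)) ∘ ext h ≈ (a ∘ ext h) · q
  ext-·ʳ = ≈-trans ∘-assoc (refl⟩∘⟨ ext-⟨⟩ʳ)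

  tl-ext : {h : Hom Θ V} → IsChannel h → tl ∘ ext h ≈ id
  tl-ext ch = ≈-trans ∘-assoc (≈-trans (refl⟩∘⟨ cancelˡ KJ) (π₂-⟨⟩ ch))

  hd-ext : {h : Hom Θ V} → hd ∘ ext h ≈ h
  hd-ext = ≈-trans ∘-assoc (≈-trans (refl⟩∘⟨ cancelˡ KJ) (π₁-⟨⟩ identityʳ))

  -- Integrating the new variable against an observation leaves the likelihood of the observed value
  -- `γ` under `h`.
  cap-ext : {h γ : Hom Θ V} → (cap ∘ ⟨ hd , γ ∘ tl ⟩) ∘ ext h ≈ cap ∘ ⟨ h , γ ⟩
  cap-ext = ≈-trans ∘-assoc (refl⟩∘⟨ ≈-trans ext-⟨⟩ʳ (⟨⟩-cong hd-ext ≈-refl))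

  -- `cap-subst` conjugated by the isomorphism `J`, `K`. Afterwards the payload has the form
  -- `_ ∘ tl`, so `ext-·ʳ` can integrate the weight alone.
  ext-subst : {γ : Hom Θ V} {f : Hom Θ′ B} → Deterministic γ →
              (cap ∘ ⟨ hd , γ ∘ tl ⟩) · f ≈ (cap ∘ ⟨ hd , γ ∘ tl ⟩) · ((f ∘ ext γ) ∘ tl)
  ext-subst {γ = γ} {f} dγ = begin
    (cap ∘ ⟨ hd , γ ∘ tl ⟩) · f
      ≈⟨ ·-cong onK (≈-trans ∘-assoc (≈-trans (refl⟩∘⟨ JK) identityʳ)) ⟨
    ((cap ∘ ⟨ π₁ , γ ∘ π₂ ⟩) ∘ K) · ((f ∘ J) ∘ K)
      ≈⟨ ·-∘ det-K ⟨
    ((cap ∘ ⟨ π₁ , γ ∘ π₂ ⟩) · (f ∘ J)) ∘ K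
      ≈⟨ cap-subst dγ ⟩∘⟨refl ⟩
    ((cap ∘ ⟨ π₁ , γ ∘ π₂ ⟩) · ((f ∘ J) ∘ ⟨ γ , id ⟩ ∘ π₂)) ∘ K
      ≈⟨ ·-∘ det-K ⟩
    ((cap ∘ ⟨ π₁ , γ ∘ π₂ ⟩) ∘ K) · (((f ∘ J) ∘ ⟨ γ , id ⟩ ∘ π₂) ∘ K)
      ≈⟨ ·-cong onK (≈-trans ∘-assoc (≈-trans (refl⟩∘⟨ ∘-assoc) (≈-trans (≈-sym ∘-assoc) (∘-assoc ⟩∘⟨refl)))) ⟩
    (cap ∘ ⟨ hd , γ ∘ tl ⟩) · ((f ∘ ext γ) ∘ tl) ∎
    where
    onK : (cap ∘ ⟨ π₁ , γ ∘ π₂ ⟩) ∘ K ≈ cap ∘ ⟨ hd , γ ∘ tl ⟩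
    onK = ≈-trans ∘-assoc (refl⟩∘⟨ ≈-trans (⟨⟩-∘ det-K) (⟨⟩-cong ≈-refl ∘-assoc))

-- Marginals and splittings as deterministic projections.

module Marginals {o ℓ e : Level} (C : CDCat o ℓ e) {n : ℕ} (obj : Fin n → CDCat.Obj C) where
  open CDCat C
  open CopyDiscard C
  open HomReasoning
  open Multi C
  open Vertices obj

  private variable
    A B D Θ : Obj
    v : Fin n
    K K₁ K₂ K₃ : List (Fin n)

  cons-in-out : ∀ xs → cons-in {A} xs ∘ cons-out xs ≈ id
  cons-in-out []      = unitʳ-iso₁
  cons-in-out (_ ∷ _) = identityˡ

  cons-out-in : ∀ xs → cons-out {A} xs ∘ cons-in xs ≈ id
  cons-out-in []      = unitʳ-iso₂
  cons-out-in (_ ∷ _) = identityˡ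

  det-cons-in : ∀ xs → Deterministic (cons-in {A} xs)
  det-cons-in []      = det-unitʳ⇒
  det-cons-in (_ ∷ _) = det-id

  det-cons-out : ∀ xs → Deterministic (cons-out {A} xs)
  det-cons-out xs = det-inverse (cons-in-out xs) (cons-out-in xs) (det-cons-in xs)

  module _ (v : Fin n) (L : List (Fin n)) where
    private xs : List Obj
            xs = map obj L

    head : Hom (X (v ∷ L)) (obj v)
    head = π₁ ∘ cons-out xs

    tail : Hom (X (v ∷ L)) (X L)
    tail = π₂ ∘ cons-out xs

    det-head : Deterministic head
    det-head = det-∘ det-π₁ (det-cons-out xs)

    det-tail : Deterministic tail
    det-tail = det-∘ det-π₂ (det-cons-out xs)

    cons-out-⟨⟩ : cons-out xs ≈ ⟨ head , tail ⟩
    cons-out-⟨⟩ = ≈-sym (⟨⟩-η (det-cons-out xs))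

    ⊗-cons-out : {f : Hom (X L) A} → (id ⊗₁ f) ∘ cons-out xs ≈ ⟨ head , f ∘ tail ⟩
    ⊗-cons-out = ≈-trans (refl⟩∘⟨ cons-out-⟨⟩) (≈-trans ⊗-∘-⟨⟩ (⟨⟩-cong identityˡ ≈-refl))

  det-put : ∀ b → Deterministic (put b v K)
  det-put {K = K} true = det-cons-in (map obj K)
  det-put false = det-π₂

  det-marg : ∀ p L → Deterministic (marg p L)
  det-marg p []      = det-id
  det-marg p (v ∷ L) =
    det-∘ (det-put (p v)) (det-∘ (det-⊗ det-id (det-marg p L)) (det-cons-out (map obj L)))

  marg-∷ : ∀ p v L → marg p (v ∷ L) ≈ put (p v) v (keep p L) ∘ ⟨ head v L , marg p L ∘ tail v L ⟩
  marg-∷ p v L = refl⟩∘⟨ ⊗-cons-out v L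

  midswap-Δ-⟨⟩ : {u : Hom Θ D} {f : Hom Θ A} {g : Hom Θ B} → Deterministic u →
                 (midswap ∘ (Δ ⊗₁ id)) ∘ ⟨ u , ⟨ f , g ⟩ ⟩ ≈ ⟨ ⟨ u , f ⟩ , ⟨ u , g ⟩ ⟩
  midswap-Δ-⟨⟩ du = ≈-trans ∘-assoc (≈-trans
    (refl⟩∘⟨ ≈-trans ⊗-∘-⟨⟩ (⟨⟩-cong (copy du) identityˡ)) midswap-⟨⟩)

  step2-⟨⟩ : ∀ a b K₁ K₂ {u : Hom Θ (obj v)} {f : Hom Θ (X K₁)} {g : Hom Θ (X K₂)} → Deterministic u →
             step2 a b v K₁ K₂ ∘ ⟨ u , ⟨ f , g ⟩ ⟩
             ≈ ⟨ put a v K₁ ∘ ⟨ u , f ⟩ , put b v K₂ ∘ ⟨ u , g ⟩ ⟩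
  step2-⟨⟩ true true K₁ K₂ du = ≈-trans ∘-assoc (≈-trans (refl⟩∘⟨ midswap-Δ-⟨⟩ du) ⊗-∘-⟨⟩)
  step2-⟨⟩ true false K₁ K₂ du = ≈-trans ∘-assoc (≈-trans (refl⟩∘⟨ assoc⇐-⟨⟩)
    (≈-trans ⊗-∘-⟨⟩ (⟨⟩-cong ≈-refl (≈-trans identityˡ (≈-sym (π₂-⟨⟩ (discard du)))))))
  step2-⟨⟩ false true K₁ K₂ du = ≈-trans ∘-assoc (≈-trans (refl⟩∘⟨ pushR-⟨⟩)
    (≈-trans ⊗-∘-⟨⟩ (⟨⟩-cong (≈-trans identityˡ (≈-sym (π₂-⟨⟩ (discard du)))) ≈-refl)))
  step2-⟨⟩ false false K₁ K₂ du = ≈-trans (π₂-⟨⟩ (discard du))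
    (≈-sym (⟨⟩-cong (π₂-⟨⟩ (discard du)) (π₂-⟨⟩ (discard du))))

  copy-step-⟨⟩ : ∀ K {s : Hom (obj v ⊗₀ (A ⊗₀ B)) D} {u : Hom Θ (obj v)} {f : Hom Θ A} {g : Hom Θ B}
                 {h : Hom Θ (X K)} {k : Hom Θ D} → Deterministic u → s ∘ ⟨ u , ⟨ f , g ⟩ ⟩ ≈ k →
                 ((s ⊗₁ cons-in (map obj K)) ∘ (midswap ∘ (Δ ⊗₁ id))) ∘ ⟨ u , ⟨ ⟨ f , g ⟩ , h ⟩ ⟩
                 ≈ ⟨ k , put true v K ∘ ⟨ u , h ⟩ ⟩
  copy-step-⟨⟩ K du eq = ≈-trans ∘-assoc (≈-trans (refl⟩∘⟨ midswap-Δ-⟨⟩ du)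
    (≈-trans ⊗-∘-⟨⟩ (⟨⟩-cong eq ≈-refl)))

  left-step-⟨⟩ : ∀ K {s : Hom (obj v ⊗₀ (A ⊗₀ B)) D} {u : Hom Θ (obj v)} {f : Hom Θ A} {g : Hom Θ B}
                 {h : Hom Θ (X K)} {k : Hom Θ D} → Deterministic u → s ∘ ⟨ u , ⟨ f , g ⟩ ⟩ ≈ k →
                 ((s ⊗₁ id) ∘ assoc⇐) ∘ ⟨ u , ⟨ ⟨ f , g ⟩ , h ⟩ ⟩
                 ≈ ⟨ k , put false v K ∘ ⟨ u , h ⟩ ⟩
  left-step-⟨⟩ K du eq = ≈-trans ∘-assoc (≈-trans (refl⟩∘⟨ assoc⇐-⟨⟩)
    (≈-trans ⊗-∘-⟨⟩ (⟨⟩-cong eq (≈-trans identityˡ (≈-sym (π₂-⟨⟩ (discard du)))))))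

  step3-⟨⟩ : ∀ a b c K₁ K₂ K₃ {u : Hom Θ (obj v)} {f : Hom Θ (X K₁)} {g : Hom Θ (X K₂)} {h : Hom Θ (X K₃)} →
             Deterministic u →
             step3 a b c v K₁ K₂ K₃ ∘ ⟨ u , ⟨ ⟨ f , g ⟩ , h ⟩ ⟩
             ≈ ⟨ ⟨ put a v K₁ ∘ ⟨ u , f ⟩ , put b v K₂ ∘ ⟨ u , g ⟩ ⟩ , put c v K₃ ∘ ⟨ u , h ⟩ ⟩
  step3-⟨⟩ false false false K₁ K₂ K₃ du = ≈-trans (π₂-⟨⟩ (discard du)) (≈-sym
    (⟨⟩-cong (⟨⟩-cong (π₂-⟨⟩ (discard du)) (π₂-⟨⟩ (discard du))) (π₂-⟨⟩ (discard du))))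
  step3-⟨⟩ false false true K₁ K₂ K₃ du = ≈-trans ∘-assoc (≈-trans (refl⟩∘⟨ pushR-⟨⟩) (≈-trans ⊗-∘-⟨⟩
    (⟨⟩-cong (≈-trans identityˡ (≈-sym
      (⟨⟩-cong (π₂-⟨⟩ (discard du)) (π₂-⟨⟩ (discard du))))) ≈-refl)))
  step3-⟨⟩ true  b    true K₁ K₂ K₃ du = copy-step-⟨⟩ K₃ du (step2-⟨⟩ true b K₁ K₂ du)
  step3-⟨⟩ false true true K₁ K₂ K₃ du = copy-step-⟨⟩ K₃ du (step2-⟨⟩ false true K₁ K₂ du)
  step3-⟨⟩ true  b    false K₁ K₂ K₃ du = left-step-⟨⟩ K₃ du (step2-⟨⟩ true b K₁ K₂ du)
  step3-⟨⟩ false true false K₁ K₂ K₃ du = left-step-⟨⟩ K₃ du (step2-⟨⟩ false true K₁ K₂ du)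

  -- The cases of `step2` copy, move or discard the head, which on tuples is one `put` per
  -- component. From here on only `marg` has to be understood.
  split2-marg : ∀ S T L → split2 S T L ≈ ⟨ marg (vlookup S) L , marg (vlookup T) L ⟩
  split2-marg S T [] = ≈-trans (≈-sym Δ-I) Δ-⟨⟩
  split2-marg S T (v ∷ L) = begin
    step ∘ (id ⊗₁ split2 S T L) ∘ cons-out (map obj L)
      ≈⟨ refl⟩∘⟨ ⊗-cons-out v L ⟩
    step ∘ ⟨ head v L , split2 S T L ∘ tail v L ⟩
      ≈⟨ refl⟩∘⟨ ⟨⟩-cong ≈-refl (≈-trans (split2-marg S T L ⟩∘⟨refl) (⟨⟩-∘ (det-tail v L))) ⟩
    step ∘ ⟨ head v L , ⟨ marg s L ∘ tail v L , marg t L ∘ tail v L ⟩ ⟩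
      ≈⟨ step2-⟨⟩ (s v) (t v) (keep s L) (keep t L) (det-head v L) ⟩
    ⟨ put (s v) v (keep s L) ∘ ⟨ head v L , marg s L ∘ tail v L ⟩
    , put (t v) v (keep t L) ∘ ⟨ head v L , marg t L ∘ tail v L ⟩ ⟩
      ≈⟨ ⟨⟩-cong (marg-∷ s v L) (marg-∷ t v L) ⟨
    ⟨ marg s (v ∷ L) , marg t (v ∷ L) ⟩ ∎
    where
    s t : Fin n → Bool
    s = vlookup S
    t = vlookup T
    step : Hom (obj v ⊗₀ (X (keep s L) ⊗₀ X (keep t L))) (X (keep s (v ∷ L)) ⊗₀ X (keep t (v ∷ L)))
    step = step2 (s v) (t v) v (keep s L) (keep t L)

  split3-marg : ∀ Y Z W L → split3 Y Z W L
                ≈ ⟨ ⟨ marg (vlookup Y) L , marg (vlookup Z) L ⟩ , marg (vlookup W) L ⟩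
  split3-marg Y Z W [] = begin
    (unitˡ⇐ ⊗₁ id) ∘ unitˡ⇐          ≈⟨ refl⟩∘⟨ ≈-trans (≈-sym Δ-I) Δ-⟨⟩ ⟩
    (unitˡ⇐ ⊗₁ id) ∘ ⟨ id , id ⟩     ≈⟨ ⊗-∘-⟨⟩ ⟩
    ⟨ unitˡ⇐ ∘ id , id ∘ id ⟩        ≈⟨ ⟨⟩-cong (≈-trans identityʳ (≈-trans (≈-sym Δ-I) Δ-⟨⟩)) identityˡ ⟩
    ⟨ ⟨ id , id ⟩ , id ⟩             ∎
  split3-marg Y Z W (v ∷ L) = begin
    step ∘ (id ⊗₁ split3 Y Z W L) ∘ cons-out (map obj L)
      ≈⟨ refl⟩∘⟨ ⊗-cons-out v L ⟩
    step ∘ ⟨ head v L , split3 Y Z W L ∘ tail v L ⟩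
      ≈⟨ refl⟩∘⟨ ⟨⟩-cong ≈-refl (≈-trans (split3-marg Y Z W L ⟩∘⟨refl)
           (≈-trans (⟨⟩-∘ (det-tail v L)) (⟨⟩-cong (⟨⟩-∘ (det-tail v L)) ≈-refl))) ⟩
    step ∘ ⟨ head v L , ⟨ ⟨ marg y L ∘ tail v L , marg z L ∘ tail v L ⟩ , marg w L ∘ tail v L ⟩ ⟩
      ≈⟨ step3-⟨⟩ (y v) (z v) (w v) (keep y L) (keep z L) (keep w L) (det-head v L) ⟩
    ⟨ ⟨ put (y v) v (keep y L) ∘ ⟨ head v L , marg y L ∘ tail v L ⟩
      , put (z v) v (keep z L) ∘ ⟨ head v L , marg z L ∘ tail v L ⟩ ⟩
    , put (w v) v (keep w L) ∘ ⟨ head v L , marg w L ∘ tail v L ⟩ ⟩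
      ≈⟨ ⟨⟩-cong (⟨⟩-cong (marg-∷ y v L) (marg-∷ z v L)) (marg-∷ w v L) ⟨
    ⟨ ⟨ marg y (v ∷ L) , marg z (v ∷ L) ⟩ , marg w (v ∷ L) ⟩ ∎
    where
    y z w : Fin n → Bool
    y = vlookup Y
    z = vlookup Z
    w = vlookup W
    step : Hom (obj v ⊗₀ ((X (keep y L) ⊗₀ X (keep z L)) ⊗₀ X (keep w L)))
               ((X (keep y (v ∷ L)) ⊗₀ X (keep z (v ∷ L))) ⊗₀ X (keep w (v ∷ L)))
    step = step3 (y v) (z v) (w v) v (keep y L) (keep z L) (keep w L)

  -- The inductive step of `marg-mono`. The map `r′` is chosen before `u` and `m`, so it is a map
  -- between marginals, independent of the context.
  put-mono : ∀ a b K₁ K₂ → (a ≡ true → b ≡ true) → (r : Hom (X K₂) (X K₁)) →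
             Σ[ r′ ∈ Hom (X (consIf b v K₂)) (X (consIf a v K₁)) ]
               (∀ {Θ} {u : Hom Θ (obj v)} {m : Hom Θ (X K₂)} → IsChannel u →
                put a v K₁ ∘ ⟨ u , r ∘ m ⟩ ≈ r′ ∘ put b v K₂ ∘ ⟨ u , m ⟩)
  put-mono true true K₁ K₂ _ r = in₁ ∘ (id ⊗₁ r) ∘ out₂ , λ {_} {u} {m} ch → ≈-sym (begin
    (in₁ ∘ (id ⊗₁ r) ∘ out₂) ∘ in₂ ∘ ⟨ u , m ⟩   ≈⟨ ≈-trans ∘-assoc (refl⟩∘⟨ ∘-assoc) ⟩
    in₁ ∘ (id ⊗₁ r) ∘ out₂ ∘ in₂ ∘ ⟨ u , m ⟩     ≈⟨ refl⟩∘⟨ refl⟩∘⟨ cancelˡ (cons-out-in (map obj K₂)) ⟩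
    in₁ ∘ (id ⊗₁ r) ∘ ⟨ u , m ⟩                  ≈⟨ refl⟩∘⟨ ≈-trans ⊗-∘-⟨⟩ (⟨⟩-cong identityˡ ≈-refl) ⟩
    in₁ ∘ ⟨ u , r ∘ m ⟩                          ∎)
    where
    in₁  = cons-in (map obj K₁)
    in₂  = cons-in (map obj K₂)
    out₂ = cons-out (map obj K₂)
  put-mono true false K₁ K₂ imp r with () ← imp refl
  put-mono {v = v} false true K₁ K₂ _ r = r ∘ tail v K₂ , λ ch → ≈-trans (π₂-⟨⟩ ch) (≈-sym
    (≈-trans ∘-assoc (refl⟩∘⟨ ≈-trans ∘-assoc
      (≈-trans (refl⟩∘⟨ cancelˡ (cons-out-in (map obj K₂))) (π₂-⟨⟩ ch)))))
  put-mono false false K₁ K₂ _ r = r , λ ch → ≈-trans (π₂-⟨⟩ ch) (refl⟩∘⟨ ≈-sym (π₂-⟨⟩ ch))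

  marg-mono : ∀ p s → (∀ v → p v ≡ true → s v ≡ true) → ∀ L →
              Σ[ r ∈ Hom (X (keep s L)) (X (keep p L)) ] marg p L ≈ r ∘ marg s L
  marg-mono p s p⊆s [] = id , ≈-sym identityˡ
  marg-mono p s p⊆s (v ∷ L) with marg-mono p s p⊆s L
  ... | r , eq with put-mono (p v) (s v) (keep p L) (keep s L) (p⊆s v) r
  ... | r′ , eq′ = r′ , (begin
    marg p (v ∷ L)                                                    ≈⟨ marg-∷ p v L ⟩
    put (p v) v (keep p L) ∘ ⟨ head v L , marg p L ∘ tail v L ⟩       ≈⟨ refl⟩∘⟨ ⟨⟩-cong ≈-refl (≈-trans (eq ⟩∘⟨refl) ∘-assoc) ⟩
    put (p v) v (keep p L) ∘ ⟨ head v L , r ∘ marg s L ∘ tail v L ⟩   ≈⟨ eq′ (discard (det-head v L)) ⟩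
    r′ ∘ put (s v) v (keep s L) ∘ ⟨ head v L , marg s L ∘ tail v L ⟩  ≈⟨ refl⟩∘⟨ marg-∷ s v L ⟨
    r′ ∘ marg s (v ∷ L)                                               ∎)

-- Factorising a state along a separation of its graph.

-- In the moral graph of the ancestral set, w is the separator, s₁ and s₂ are the two sides
-- together with w, and vertices outside s₁ ∪ s₂ are not ancestral.
module _ {n : ℕ} (E : Fin n → Fin n → Bool) where

  ParentsIn : (Fin n → Bool) → Fin n → Set
  ParentsIn s v = ∀ u → E u v ≡ true → s u ≡ true

  -- What elimination of `v` needs. An observed vertex contributes a likelihood of its parents,
  -- which must fit into one factor. An unobserved vertex has to be absent from a factor that does
  -- not absorb its mechanism.
  data Role (s₁ s₂ : Fin n → Bool) (v : Fin n) : Bool → Set where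
    separator : ParentsIn s₁ v ⊎ ParentsIn s₂ v → Role s₁ s₂ v true
    left      : s₂ v ≡ false → ParentsIn s₁ v → Role s₁ s₂ v false
    right     : s₁ v ≡ false → ParentsIn s₂ v → Role s₁ s₂ v false
    neither   : s₁ v ≡ false → s₂ v ≡ false → Role s₁ s₂ v false

module Factorising {o ℓ e : Level} {C : CDCat o ℓ e} (EC : EffectConditioning C)
                   {n : ℕ} (obj : Fin n → CDCat.Obj C) (E : Fin n → Fin n → Bool)
                   (w s₁ s₂ : Fin n → Bool) (roles : (v : Fin n) → Role E s₁ s₂ v (w v))
                   (Γ B₁ B₂ : CDCat.Obj C) where
  open CDCat C
  open EffectConditioning EC
  open CopyDiscard C
  open HomReasoning
  open EffectAction C
  open Caps EC
  open Marginals C obj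
  open Multi C
  open Vertices obj
  open Factorisation E

  private variable
    A B D : Obj
    v : Fin n
    L : List (Fin n)
    s : Fin n → Bool

  -- `Γ` holds the observed values and is available in full to every kernel, so the restriction to
  -- `s` concerns the random variables only.
  record DependsOn (s : Fin n → Bool) (L : List (Fin n)) {B : Obj} (f : Hom (X L ⊗₀ Γ) B) : Set (ℓ ⊔ e) where
    constructor via
    field
      kernel : Hom (X (keep s L) ⊗₀ Γ) B
      factor : f ≈ kernel ∘ (marg s L ⊗₁ id)

  det-restrict : ∀ s L → Deterministic (marg s L ⊗₁ id {Γ})
  det-restrict s L = det-⊗ (det-marg s L) det-id

  dep-∘ : {k : Hom B D} {f : Hom (X L ⊗₀ Γ) B} → DependsOn s L f → DependsOn s L (k ∘ f)
  dep-∘ {k = k} (via f′ eq) = via (k ∘ f′) (≈-trans (refl⟩∘⟨ eq) (≈-sym ∘-assoc))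

  dep-⟨⟩ : {f : Hom (X L ⊗₀ Γ) B} {g : Hom (X L ⊗₀ Γ) D} →
           DependsOn s L f → DependsOn s L g → DependsOn s L ⟨ f , g ⟩
  dep-⟨⟩ {L = L} {s = s} (via f′ eqf) (via g′ eqg) =
    via ⟨ f′ , g′ ⟩ (≈-trans (⟨⟩-cong eqf eqg) (≈-sym (⟨⟩-∘ (det-restrict s L))))

  dep-parameter : {g : Hom Γ B} → DependsOn s L (g ∘ π₂)
  dep-parameter {s = s} {L = L} {g = g} = via (g ∘ π₂) (begin
    g ∘ π₂                                ≈⟨ refl⟩∘⟨ ≈-trans (π₂-⟨⟩ (discard (det-∘ (det-marg s L) det-π₁))) identityˡ ⟨
    g ∘ π₂ ∘ ⟨ marg s L ∘ π₁ , id ∘ π₂ ⟩  ≈⟨ refl⟩∘⟨ refl⟩∘⟨ ⊗-⟨⟩ ⟨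
    g ∘ π₂ ∘ (marg s L ⊗₁ id)             ≈⟨ ∘-assoc ⟨
    (g ∘ π₂) ∘ (marg s L ⊗₁ id)           ∎)

  dep-marg : ∀ p → (∀ u → p u ≡ true → s u ≡ true) → ∀ L → DependsOn s L (marg p L ∘ π₁)
  dep-marg {s = s} p p⊆s L with marg-mono p s p⊆s L
  ... | r , eq = via (r ∘ π₁) (begin
    marg p L ∘ π₁                                ≈⟨ ≈-trans (eq ⟩∘⟨refl) ∘-assoc ⟩
    r ∘ marg s L ∘ π₁                            ≈⟨ refl⟩∘⟨ π₁-⟨⟩ (≈-trans (refl⟩∘⟨ identityˡ) (discard det-π₂)) ⟨
    r ∘ π₁ ∘ ⟨ marg s L ∘ π₁ , id ∘ π₂ ⟩         ≈⟨ refl⟩∘⟨ refl⟩∘⟨ ⊗-⟨⟩ ⟨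
    r ∘ π₁ ∘ (marg s L ⊗₁ id)                    ≈⟨ ∘-assoc ⟨
    (r ∘ π₁) ∘ (marg s L ⊗₁ id)                  ∎)

  module AddVertex (v : Fin n) (L : List (Fin n)) where
    private
      xs : List Obj
      xs = map obj L

      unfold : Hom (X (v ∷ L) ⊗₀ Γ) (obj v ⊗₀ (X L ⊗₀ Γ))
      unfold = assoc⇒ ∘ (cons-out xs ⊗₁ id)

      fold : Hom (obj v ⊗₀ (X L ⊗₀ Γ)) (X (v ∷ L) ⊗₀ Γ)
      fold = (cons-in xs ⊗₁ id) ∘ assoc⇐

      fold-unfold : fold ∘ unfold ≈ id
      fold-unfold = ≈-trans ∘-assoc (≈-trans (refl⟩∘⟨ cancelˡ assoc-iso₂)
        (≈-trans (≈-sym ⊗-∘) (⊗-resp-id (cons-in-out xs) identityˡ)))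

      unfold-fold : unfold ∘ fold ≈ id
      unfold-fold = ≈-trans ∘-assoc (≈-trans
        (refl⟩∘⟨ cancelˡ (≈-trans (≈-sym ⊗-∘) (⊗-resp-id (cons-out-in xs) identityˡ)))
        assoc-iso₁)

    open Extension EC fold unfold fold-unfold unfold-fold
      (det-∘ det-assoc⇒ (det-⊗ (det-cons-out xs) det-id)) public

    unfold-⟨⟩ : unfold ≈ ⟨ head v L ∘ π₁ , ⟨ tail v L ∘ π₁ , π₂ ⟩ ⟩
    unfold-⟨⟩ = begin
      assoc⇒ ∘ (cons-out xs ⊗₁ id)                              ≈⟨ refl⟩∘⟨ ≈-trans ⊗-⟨⟩ (⟨⟩-cong (cons-out-⟨⟩ v L ⟩∘⟨refl) identityˡ) ⟩
      assoc⇒ ∘ ⟨ ⟨ head v L , tail v L ⟩ ∘ π₁ , π₂ ⟩            ≈⟨ refl⟩∘⟨ ⟨⟩-cong (⟨⟩-∘ det-π₁) ≈-refl ⟩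
      assoc⇒ ∘ ⟨ ⟨ head v L ∘ π₁ , tail v L ∘ π₁ ⟩ , π₂ ⟩       ≈⟨ assoc-⟨⟩ ⟩
      ⟨ head v L ∘ π₁ , ⟨ tail v L ∘ π₁ , π₂ ⟩ ⟩                ∎

    hd-π₁ : hd ≈ head v L ∘ π₁
    hd-π₁ = ≈-trans (refl⟩∘⟨ unfold-⟨⟩)
      (π₁-⟨⟩ (discard (det-⟨⟩ (det-∘ (det-tail v L) det-π₁) det-π₂)))

    tl-⟨⟩ : tl ≈ ⟨ tail v L ∘ π₁ , π₂ ⟩
    tl-⟨⟩ = ≈-trans (refl⟩∘⟨ unfold-⟨⟩) (π₂-⟨⟩ (discard (det-∘ (det-head v L) det-π₁)))

    π₁-tl : π₁ ∘ tl ≈ tail v L ∘ π₁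
    π₁-tl = ≈-trans (refl⟩∘⟨ tl-⟨⟩) (π₁-⟨⟩ (discard det-π₂))

    π₂-tl : π₂ ∘ tl ≈ π₂
    π₂-tl = ≈-trans (refl⟩∘⟨ tl-⟨⟩) (π₂-⟨⟩ (discard (det-∘ (det-tail v L) det-π₁)))

    tl-⊗ : tl ≈ tail v L ⊗₁ id
    tl-⊗ = ≈-trans tl-⟨⟩ (≈-sym (≈-trans ⊗-⟨⟩ (⟨⟩-cong ≈-refl identityˡ)))

    ext-build : {k : Hom (X L) (obj v)} {b : Hom I (X L)} →
                (cons-in xs ∘ (k ⊗₁ id) ∘ Δ ∘ b) ⊗₁ id ≈ ext (k ∘ π₁) ∘ (b ⊗₁ id)
    ext-build {k} {b} = begin
      (cons-in xs ∘ (k ⊗₁ id) ∘ Δ ∘ b) ⊗₁ id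
        ≈⟨ ⊗-resp-≈ (≈-trans (refl⟩∘⟨ ≈-sym ∘-assoc) (≈-sym ∘-assoc)) (≈-sym identityˡ) ⟩
      ((cons-in xs ∘ ⟨ k , id ⟩) ∘ b) ⊗₁ (id ∘ id)
        ≈⟨ ⊗-∘ ⟩
      ((cons-in xs ∘ ⟨ k , id ⟩) ⊗₁ id) ∘ (b ⊗₁ id)
        ≈⟨ ≈-trans (⊗-resp-≈ ≈-refl (≈-sym identityˡ)) ⊗-∘ ⟩∘⟨refl ⟩
      ((cons-in xs ⊗₁ id) ∘ (⟨ k , id ⟩ ⊗₁ id)) ∘ (b ⊗₁ id)
        ≈⟨ (refl⟩∘⟨ ≈-trans ⊗-⟨⟩ (⟨⟩-cong (≈-trans (⟨⟩-∘ det-π₁) (⟨⟩-cong ≈-refl identityˡ)) identityˡ)) ⟩∘⟨refl ⟩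
      ((cons-in xs ⊗₁ id) ∘ ⟨ ⟨ k ∘ π₁ , π₁ ⟩ , π₂ ⟩) ∘ (b ⊗₁ id)
        ≈⟨ (refl⟩∘⟨ assoc⇐-⟨⟩) ⟩∘⟨refl ⟨
      ((cons-in xs ⊗₁ id) ∘ assoc⇐ ∘ ⟨ k ∘ π₁ , ⟨ π₁ , π₂ ⟩ ⟩) ∘ (b ⊗₁ id)
        ≈⟨ ≈-trans (≈-sym ∘-assoc) (refl⟩∘⟨ ⟨⟩-cong ≈-refl ⟨π₁,π₂⟩) ⟩∘⟨refl ⟩
      ext (k ∘ π₁) ∘ (b ⊗₁ id) ∎

    dep-ext : {f : Hom (X (v ∷ L) ⊗₀ Γ) B} {h : Hom (X L ⊗₀ Γ) (obj v)} →
              DependsOn s (v ∷ L) f → DependsOn s L h → DependsOn s L (f ∘ ext h)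
    dep-ext {s = s} {f = f} {h = h} (via f′ eqf) (via h′ eqh) =
      via (f′ ∘ (put (s v) v (keep s L) ⊗₁ id) ∘ assoc⇐ ∘ ⟨ h′ , id ⟩) (begin
        f ∘ ext h
          ≈⟨ ∘-resp-≈ eqf (refl⟩∘⟨ ⟨⟩-cong eqh (≈-sym ⟨π₁,π₂⟩)) ⟩
        (f′ ∘ (marg s (v ∷ L) ⊗₁ id)) ∘ fold ∘ ⟨ h′ ∘ m , ⟨ π₁ , π₂ ⟩ ⟩
          ≈⟨ ≈-trans ∘-assoc (refl⟩∘⟨ refl⟩∘⟨ ≈-trans ∘-assoc (refl⟩∘⟨ assoc⇐-⟨⟩)) ⟩
        f′ ∘ (marg s (v ∷ L) ⊗₁ id) ∘ (cons-in xs ⊗₁ id) ∘ ⟨ ⟨ h′ ∘ m , π₁ ⟩ , π₂ ⟩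
          ≈⟨ refl⟩∘⟨ refl⟩∘⟨ ≈-trans ⊗-∘-⟨⟩ (⟨⟩-cong ≈-refl identityˡ) ⟩
        f′ ∘ (marg s (v ∷ L) ⊗₁ id) ∘ ⟨ cons-in xs ∘ ⟨ h′ ∘ m , π₁ ⟩ , π₂ ⟩
          ≈⟨ refl⟩∘⟨ ≈-trans ⊗-∘-⟨⟩ (⟨⟩-cong marg-cons-in ≈-refl) ⟩
        f′ ∘ ⟨ put (s v) v (keep s L) ∘ ⟨ h′ ∘ m , marg s L ∘ π₁ ⟩ , id ∘ π₂ ⟩
          ≈⟨ refl⟩∘⟨ ≈-trans ⊗-∘-⟨⟩ (⟨⟩-cong ≈-refl identityˡ) ⟨
        f′ ∘ (put (s v) v (keep s L) ⊗₁ id) ∘ ⟨ ⟨ h′ ∘ m , marg s L ∘ π₁ ⟩ , id ∘ π₂ ⟩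
          ≈⟨ refl⟩∘⟨ refl⟩∘⟨ assoc⇐-⟨⟩ ⟨
        f′ ∘ (put (s v) v (keep s L) ⊗₁ id) ∘ assoc⇐ ∘ ⟨ h′ ∘ m , ⟨ marg s L ∘ π₁ , id ∘ π₂ ⟩ ⟩
          ≈⟨ refl⟩∘⟨ refl⟩∘⟨ refl⟩∘⟨ ⟨⟩-cong ≈-refl (≈-trans identityˡ ⊗-⟨⟩) ⟨
        f′ ∘ (put (s v) v (keep s L) ⊗₁ id) ∘ assoc⇐ ∘ ⟨ h′ ∘ m , id ∘ m ⟩
          ≈⟨ refl⟩∘⟨ refl⟩∘⟨ refl⟩∘⟨ ⟨⟩-∘ (det-restrict s L) ⟨
        f′ ∘ (put (s v) v (keep s L) ⊗₁ id) ∘ assoc⇐ ∘ ⟨ h′ , id ⟩ ∘ m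
          ≈⟨ ≈-trans ∘-assoc (refl⟩∘⟨ ≈-trans ∘-assoc (refl⟩∘⟨ ∘-assoc)) ⟨
        (f′ ∘ (put (s v) v (keep s L) ⊗₁ id) ∘ assoc⇐ ∘ ⟨ h′ , id ⟩) ∘ m ∎)
      where
      m : Hom (X L ⊗₀ Γ) (X (keep s L) ⊗₀ Γ)
      m = marg s L ⊗₁ id
      marg-cons-in : ∀ {a : Hom A (obj v)} {b : Hom A (X L)} →
                     marg s (v ∷ L) ∘ cons-in xs ∘ ⟨ a , b ⟩ ≈ put (s v) v (keep s L) ∘ ⟨ a , marg s L ∘ b ⟩
      marg-cons-in {a = a} {b} = begin
        marg s (v ∷ L) ∘ cons-in xs ∘ ⟨ a , b ⟩
          ≈⟨ ≈-trans ∘-assoc (refl⟩∘⟨ ≈-trans ∘-assoc (refl⟩∘⟨ cancelˡ (cons-out-in xs))) ⟩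
        put (s v) v (keep s L) ∘ (id ⊗₁ marg s L) ∘ ⟨ a , b ⟩
          ≈⟨ refl⟩∘⟨ ≈-trans ⊗-∘-⟨⟩ (⟨⟩-cong identityˡ ≈-refl) ⟩
        put (s v) v (keep s L) ∘ ⟨ a , marg s L ∘ b ⟩ ∎

    dep-strengthen : {f : Hom (X (v ∷ L) ⊗₀ Γ) B} → s v ≡ false → DependsOn s (v ∷ L) f →
                     Σ[ f₁ ∈ Hom (X L ⊗₀ Γ) B ] (f ≈ f₁ ∘ tl × DependsOn s L f₁)
    dep-strengthen {B = B} {s = s} {f = f} sv≡ (via f′ eq) = go (s v) sv≡ f′ eq
      where
      -- The value `s v` is generalised together with `f′` and its equation, because the domain of
      -- `f′` is computed from it.
      go : ∀ b → b ≡ false → (f′ : Hom (X (consIf b v (keep s L)) ⊗₀ Γ) B) →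
           f ≈ f′ ∘ ((put b v (keep s L) ∘ (id ⊗₁ marg s L) ∘ cons-out xs) ⊗₁ id) →
           Σ[ f₁ ∈ Hom (X L ⊗₀ Γ) B ] (f ≈ f₁ ∘ tl × DependsOn s L f₁)
      go false refl f′ eq = f′ ∘ (marg s L ⊗₁ id) , (begin
        f                                                                    ≈⟨ eq ⟩
        f′ ∘ ((put false v (keep s L) ∘ (id ⊗₁ marg s L) ∘ cons-out xs) ⊗₁ id)
          ≈⟨ refl⟩∘⟨ ⊗-resp-≈ (≈-trans (refl⟩∘⟨ ⊗-cons-out v L) (π₂-⟨⟩ (discard (det-head v L)))) (≈-sym identityˡ) ⟩
        f′ ∘ ((marg s L ∘ tail v L) ⊗₁ (id ∘ id))                            ≈⟨ refl⟩∘⟨ ⊗-∘ ⟩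
        f′ ∘ (marg s L ⊗₁ id) ∘ (tail v L ⊗₁ id)                             ≈⟨ refl⟩∘⟨ refl⟩∘⟨ tl-⊗ ⟨
        f′ ∘ (marg s L ⊗₁ id) ∘ tl                                           ≈⟨ ∘-assoc ⟨
        (f′ ∘ (marg s L ⊗₁ id)) ∘ tl                                         ∎)
        , via f′ ≈-refl

  -- The likelihood that `m` takes the observed values `d`. A general `d` is needed because the
  -- induction replaces it by `tail v K ∘ d`.
  weight : Hom A B → Hom Γ B → Hom (A ⊗₀ Γ) I
  weight m d = cap ∘ ⟨ m ∘ π₁ , d ∘ π₂ ⟩

  -- The empty list is a case of its own since `⨂` of a singleton has no trailing unit; there the
  -- second comparison is the trivial weight `ε`.
  cap-cons : ∀ xs {a a′ : Hom D A} {b b′ : Hom D (⨂ xs)} → IsChannel b → IsChannel b′ →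
             cap ∘ ⟨ cons-in xs ∘ ⟨ a , b ⟩ , cons-in xs ∘ ⟨ a′ , b′ ⟩ ⟩
             ≈ (cap ∘ ⟨ a , a′ ⟩) · (cap ∘ ⟨ b , b′ ⟩)
  cap-cons [] {a} {a′} {b} {b′} ch ch′ = begin
    cap ∘ ⟨ unitʳ⇒ ∘ ⟨ a , b ⟩ , unitʳ⇒ ∘ ⟨ a′ , b′ ⟩ ⟩  ≈⟨ refl⟩∘⟨ ⟨⟩-cong (drop ch) (drop ch′) ⟩
    cap ∘ ⟨ a , a′ ⟩                                      ≈⟨ unitˡ-⟨⟩ ⟨
    ε · (cap ∘ ⟨ a , a′ ⟩)                                ≈⟨ ·-comm ⟩
    (cap ∘ ⟨ a , a′ ⟩) · ε                                ≈⟨ ·-cong ≈-refl unitˡ-⟨⟩ ⟨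
    (cap ∘ ⟨ a , a′ ⟩) · (unitˡ⇒ ∘ ⟨ ε , ε ⟩)
      ≈⟨ ·-cong ≈-refl (∘-resp-≈ cap-I (⟨⟩-cong (ε-unique ch) (ε-unique ch′))) ⟨
    (cap ∘ ⟨ a , a′ ⟩) · (cap ∘ ⟨ b , b′ ⟩)               ∎
    where
    drop : ∀ {x : Hom D A} {y : Hom D I} → IsChannel y → unitʳ⇒ ∘ ⟨ x , y ⟩ ≈ x
    drop ch = ≈-trans (refl⟩∘⟨ ⟨⟩-cong ≈-refl (ε-unique ch)) unitʳ-⟨⟩
  cap-cons (_ ∷ _) ch ch′ = ≈-trans (refl⟩∘⟨ ⟨⟩-cong identityˡ identityˡ) cap-⟨⟩

  module _ (v : Fin n) (L K : List (Fin n)) {m : Hom (X L) (X K)} (det-m : Deterministic m) where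
    open AddVertex v L

    weight-false : {d : Hom Γ (X K)} →
                   weight (put false v K ∘ (id ⊗₁ m) ∘ cons-out (map obj L)) d ≈ weight m d ∘ tl
    weight-false {d} = begin
      cap ∘ ⟨ (put false v K ∘ (id ⊗₁ m) ∘ cons-out (map obj L)) ∘ π₁ , d ∘ π₂ ⟩
        ≈⟨ refl⟩∘⟨ ⟨⟩-cong (≈-trans (refl⟩∘⟨ ⊗-cons-out v L) (π₂-⟨⟩ (discard (det-head v L))) ⟩∘⟨refl) ≈-refl ⟩
      cap ∘ ⟨ (m ∘ tail v L) ∘ π₁ , d ∘ π₂ ⟩
        ≈⟨ refl⟩∘⟨ ⟨⟩-cong (≈-trans ∘-assoc (≈-trans (refl⟩∘⟨ ≈-sym π₁-tl) (≈-sym ∘-assoc)))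
                           (≈-trans (refl⟩∘⟨ ≈-sym π₂-tl) (≈-sym ∘-assoc)) ⟩
      cap ∘ ⟨ (m ∘ π₁) ∘ tl , (d ∘ π₂) ∘ tl ⟩
        ≈⟨ ≈-trans (refl⟩∘⟨ ≈-sym (⟨⟩-∘ det-tl)) (≈-sym ∘-assoc) ⟩
      weight m d ∘ tl ∎

    weight-true : {d : Hom Γ (X (v ∷ K))} → Deterministic d →
                  weight (put true v K ∘ (id ⊗₁ m) ∘ cons-out (map obj L)) d
                  ≈ (cap ∘ ⟨ hd , (head v K ∘ d ∘ π₂) ∘ tl ⟩) · (weight m (tail v K ∘ d) ∘ tl)
    weight-true {d} det-d = begin
      cap ∘ ⟨ (in₁ ∘ (id ⊗₁ m) ∘ cons-out (map obj L)) ∘ π₁ , d ∘ π₂ ⟩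
        ≈⟨ refl⟩∘⟨ ⟨⟩-cong split-marg split-parameter ⟩
      cap ∘ ⟨ in₁ ∘ ⟨ hd , (m ∘ π₁) ∘ tl ⟩ , in₁ ∘ ⟨ (head v K ∘ d ∘ π₂) ∘ tl , ((tail v K ∘ d) ∘ π₂) ∘ tl ⟩ ⟩
        ≈⟨ cap-cons (map obj K) (discard (det-∘ (det-∘ det-m det-π₁) det-tl))
             (discard (det-∘ (det-∘ (det-∘ (det-tail v K) det-d) det-π₂) det-tl)) ⟩
      (cap ∘ ⟨ hd , (head v K ∘ d ∘ π₂) ∘ tl ⟩) · (cap ∘ ⟨ (m ∘ π₁) ∘ tl , ((tail v K ∘ d) ∘ π₂) ∘ tl ⟩)
        ≈⟨ ·-cong ≈-refl (≈-trans (refl⟩∘⟨ ≈-sym (⟨⟩-∘ det-tl)) (≈-sym ∘-assoc)) ⟩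
      (cap ∘ ⟨ hd , (head v K ∘ d ∘ π₂) ∘ tl ⟩) · (weight m (tail v K ∘ d) ∘ tl) ∎
      where
      in₁ : Hom (obj v ⊗₀ X K) (X (v ∷ K))
      in₁ = cons-in (map obj K)

      split-marg : (in₁ ∘ (id ⊗₁ m) ∘ cons-out (map obj L)) ∘ π₁ ≈ in₁ ∘ ⟨ hd , (m ∘ π₁) ∘ tl ⟩
      split-marg = begin
        (in₁ ∘ (id ⊗₁ m) ∘ cons-out (map obj L)) ∘ π₁     ≈⟨ ≈-trans ((refl⟩∘⟨ ⊗-cons-out v L) ⟩∘⟨refl) ∘-assoc ⟩
        in₁ ∘ ⟨ head v L , m ∘ tail v L ⟩ ∘ π₁            ≈⟨ refl⟩∘⟨ ⟨⟩-∘ det-π₁ ⟩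
        in₁ ∘ ⟨ head v L ∘ π₁ , (m ∘ tail v L) ∘ π₁ ⟩
          ≈⟨ refl⟩∘⟨ ⟨⟩-cong (≈-sym hd-π₁) (≈-trans ∘-assoc (≈-trans (refl⟩∘⟨ ≈-sym π₁-tl) (≈-sym ∘-assoc))) ⟩
        in₁ ∘ ⟨ hd , (m ∘ π₁) ∘ tl ⟩                      ∎

      split-parameter : d ∘ π₂ ≈ in₁ ∘ ⟨ (head v K ∘ d ∘ π₂) ∘ tl , ((tail v K ∘ d) ∘ π₂) ∘ tl ⟩
      split-parameter = begin
        d ∘ π₂                                                  ≈⟨ cancelˡ (cons-in-out (map obj K)) ⟨
        in₁ ∘ cons-out (map obj K) ∘ d ∘ π₂                     ≈⟨ refl⟩∘⟨ cons-out-⟨⟩ v K ⟩∘⟨refl ⟩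
        in₁ ∘ ⟨ head v K , tail v K ⟩ ∘ d ∘ π₂                  ≈⟨ refl⟩∘⟨ ⟨⟩-∘ (det-∘ det-d det-π₂) ⟩
        in₁ ∘ ⟨ head v K ∘ d ∘ π₂ , tail v K ∘ d ∘ π₂ ⟩
          ≈⟨ refl⟩∘⟨ ⟨⟩-cong (drop-tl ≈-refl) (drop-tl ∘-assoc) ⟨
        in₁ ∘ ⟨ (head v K ∘ d ∘ π₂) ∘ tl , ((tail v K ∘ d) ∘ π₂) ∘ tl ⟩ ∎
        where
        drop-tl : ∀ {A} {k : Hom (X (v ∷ K)) A} {f : Hom (X L ⊗₀ Γ) A} → f ≈ k ∘ d ∘ π₂ → f ∘ tl ≈ k ∘ d ∘ π₂
        drop-tl eq = ≈-trans (eq ⟩∘⟨refl) (≈-trans ∘-assoc (refl⟩∘⟨ ≈-trans ∘-assoc (refl⟩∘⟨ π₂-tl)))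

  record Splits {L : List (Fin n)} (b : Hom I (X L)) (F : Hom (X L ⊗₀ Γ) (B₁ ⊗₀ B₂)) : Set (ℓ ⊔ e) where
    constructor splits
    field
      {left-factor}  : Hom (I ⊗₀ Γ) B₁
      {right-factor} : Hom (I ⊗₀ Γ) B₂
      factorisation  : F ∘ (b ⊗₁ id) ≈ ⟨ left-factor , right-factor ⟩

  -- The induction statement. It quantifies over `d`, `f` and `g` because each eliminated vertex
  -- changes them, and over `m` so that `marg w` can appear unfolded.
  ConditionalSplits : (L : List (Fin n)) → Hom I (X L) → (K : List (Fin n)) → Hom (X L) (X K) → Set (ℓ ⊔ e)
  ConditionalSplits L b K m =
    (d : Hom Γ (X K)) → Deterministic d →
    (f : Hom (X L ⊗₀ Γ) B₁) (g : Hom (X L ⊗₀ Γ) B₂) → DependsOn s₁ L f → DependsOn s₂ L g →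
    Splits {L} b (weight m d · ⟨ f , g ⟩)

  module Step (v : Fin n) (L : List (Fin n)) (b : Hom I (X L))
              (c : Hom (X (keep (parent v) L)) (obj v)) (c-channel : IsChannel c)
              (ih : ConditionalSplits L b (keep w L) (marg w L)) where
    open AddVertex v L

    K : List (Fin n)
    K = keep w L

    m : Hom (X L) (X K)
    m = marg w L

    mechanism : Hom (X L ⊗₀ Γ) (obj v)
    mechanism = c ∘ marg (parent v) L ∘ π₁

    b′ : Hom I (X (v ∷ L))
    b′ = cons-in (map obj L) ∘ ((c ∘ marg (parent v) L) ⊗₁ id) ∘ Δ ∘ b

    dep-mechanism : ParentsIn E s v → DependsOn s L mechanism
    dep-mechanism pa⊆s = dep-∘ (dep-marg (parent v) pa⊆s L)

    channel-mechanism : IsChannel mechanism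
    channel-mechanism = ≈-trans (pullˡ c-channel) (discard (det-∘ (det-marg (parent v) L) det-π₁))

    -- The state `b′` is `b` followed by `ext mechanism` (`ext-build`), so precomposition with that
    -- extension integrates out `v`.
    integrate : {F : Hom (X (v ∷ L) ⊗₀ Γ) (B₁ ⊗₀ B₂)} {F′ : Hom (X L ⊗₀ Γ) (B₁ ⊗₀ B₂)} →
                F ∘ ext mechanism ≈ F′ → Splits {L} b F′ → Splits {v ∷ L} b′ F
    integrate eq (splits eq′) = splits (≈-trans
      (≈-trans (refl⟩∘⟨ ≈-trans ext-build ((refl⟩∘⟨ ⟨⟩-cong ∘-assoc ≈-refl) ⟩∘⟨refl)) (pullˡ eq))
      eq′)

    module Marginalised (d : Hom Γ (X K)) (f : Hom (X (v ∷ L) ⊗₀ Γ) B₁) (g : Hom (X (v ∷ L) ⊗₀ Γ) B₂) where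
      F : Hom (X (v ∷ L) ⊗₀ Γ) (B₁ ⊗₀ B₂)
      F = weight (put false v K ∘ (id ⊗₁ m) ∘ cons-out (map obj L)) d · ⟨ f , g ⟩

      open-weight : {f′ : Hom (X (v ∷ L) ⊗₀ Γ) B₁} {g′ : Hom (X (v ∷ L) ⊗₀ Γ) B₂} → f ≈ f′ → g ≈ g′ →
                    F ∘ ext mechanism ≈ weight m d · (⟨ f′ , g′ ⟩ ∘ ext mechanism)
      open-weight eqf eqg =
        ≈-trans (·-cong (weight-false v L K (det-marg w L)) (⟨⟩-cong eqf eqg) ⟩∘⟨refl) ext-·ˡ

      reduce-left : ∀ {g₁} → g ≈ g₁ ∘ tl → F ∘ ext mechanism ≈ weight m d · ⟨ f ∘ ext mechanism , g₁ ⟩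
      reduce-left eq = ≈-trans (open-weight ≈-refl eq) (·-cong ≈-refl ext-⟨⟩ʳ)

      reduce-right : ∀ {f₁} → f ≈ f₁ ∘ tl → F ∘ ext mechanism ≈ weight m d · ⟨ f₁ , g ∘ ext mechanism ⟩
      reduce-right eq = ≈-trans (open-weight eq ≈-refl) (·-cong ≈-refl ext-⟨⟩ˡ)

      -- Nothing looks at `v`, so its mechanism is discarded; this is where `mechanism` being a
      -- channel enters.
      reduce-neither : ∀ {f₁ g₁} → f ≈ f₁ ∘ tl → g ≈ g₁ ∘ tl → F ∘ ext mechanism ≈ weight m d · ⟨ f₁ , g₁ ⟩
      reduce-neither eqf eqg = ≈-trans (open-weight eqf eqg) (·-cong ≈-refl
        (≈-trans (≈-sym (⟨⟩-∘ det-tl) ⟩∘⟨refl)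
          (≈-trans ∘-assoc (≈-trans (refl⟩∘⟨ tl-ext channel-mechanism) identityʳ))))

    module Conditioned (d : Hom Γ (X (v ∷ K))) (det-d : Deterministic d)
                       (f : Hom (X (v ∷ L) ⊗₀ Γ) B₁) (g : Hom (X (v ∷ L) ⊗₀ Γ) B₂) where
      γ : Hom (X L ⊗₀ Γ) (obj v)
      γ = head v K ∘ d ∘ π₂

      det-γ : Deterministic γ
      det-γ = det-∘ (det-head v K) (det-∘ det-d det-π₂)

      dep-γ : DependsOn s L γ
      dep-γ = dep-∘ dep-parameter

      d′ : Hom Γ (X K)
      d′ = tail v K ∘ d

      det-d′ : Deterministic d′
      det-d′ = det-∘ (det-tail v K) det-d

      -- The likelihood of the observed value of `v` given its parents. It goes to whichever factor
      -- may use those parents.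
      q : Hom (X L ⊗₀ Γ) I
      q = cap ∘ ⟨ mechanism , γ ⟩

      dep-q· : {f : Hom (X L ⊗₀ Γ) B} → ParentsIn E s v → DependsOn s L f → DependsOn s L (q · f)
      dep-q· pa⊆s dep = dep-∘ (dep-⟨⟩ (dep-∘ (dep-⟨⟩ (dep-mechanism pa⊆s) dep-γ)) dep)

      a : Hom (X (v ∷ L) ⊗₀ Γ) I
      a = cap ∘ ⟨ hd , γ ∘ tl ⟩

      F : Hom (X (v ∷ L) ⊗₀ Γ) (B₁ ⊗₀ B₂)
      F = weight (put true v K ∘ (id ⊗₁ m) ∘ cons-out (map obj L)) d · ⟨ f , g ⟩

      -- The comparison `a` first replaces `v` by `γ` inside both factors. Then only `a` still sees
      -- the random value of `v`, and integrating it gives `q`. Both factors may use `v` because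
      -- `ext γ`, being deterministic, distributes over the pair.
      reduce : F ∘ ext mechanism ≈ weight m d′ · (q · ⟨ f ∘ ext γ , g ∘ ext γ ⟩)
      reduce = begin
        F ∘ ext mechanism
          ≈⟨ ·-cong (weight-true v L K (det-marg w L) det-d) ≈-refl ⟩∘⟨refl ⟩
        ((a · (weight m d′ ∘ tl)) · ⟨ f , g ⟩) ∘ ext mechanism
          ≈⟨ ≈-trans (≈-sym ·-assoc) ·-swap ⟩∘⟨refl ⟩
        ((weight m d′ ∘ tl) · a · ⟨ f , g ⟩) ∘ ext mechanism
          ≈⟨ ·-cong ≈-refl (ext-subst det-γ) ⟩∘⟨refl ⟩
        ((weight m d′ ∘ tl) · a · ((⟨ f , g ⟩ ∘ ext γ) ∘ tl)) ∘ ext mechanism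
          ≈⟨ ≈-trans ext-·ˡ (·-cong ≈-refl ext-·ʳ) ⟩
        weight m d′ · (a ∘ ext mechanism) · (⟨ f , g ⟩ ∘ ext γ)
          ≈⟨ ·-cong ≈-refl (·-cong cap-ext (⟨⟩-∘ (det-ext det-γ))) ⟩
        weight m d′ · q · ⟨ f ∘ ext γ , g ∘ ext γ ⟩ ∎

      reduce-left : F ∘ ext mechanism ≈ weight m d′ · ⟨ q · (f ∘ ext γ) , g ∘ ext γ ⟩
      reduce-left = ≈-trans reduce (·-cong ≈-refl (≈-sym ⟨·,⟩))

      reduce-right : F ∘ ext mechanism ≈ weight m d′ · ⟨ f ∘ ext γ , q · (g ∘ ext γ) ⟩
      reduce-right = ≈-trans reduce (·-cong ≈-refl (≈-sym ⟨,·⟩))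

    -- Stated for a variable `a` in place of `w v`, with `marg w (v ∷ L)` unfolded, so that matching
    -- on `a` and the role fixes the types; at `w v` it is the goal by computation.
    step : ∀ a → Role E s₁ s₂ v a →
           ConditionalSplits (v ∷ L) b′ (consIf a v K) (put a v K ∘ (id ⊗₁ m) ∘ cons-out (map obj L))
    step false (left s₂v pa⊆s₁) d det-d f g dep-f dep-g =
      let g₁ , g≈ , dep-g₁ = dep-strengthen s₂v dep-g
      in integrate (Marginalised.reduce-left d f g g≈)
           (ih d det-d (f ∘ ext mechanism) g₁ (dep-ext dep-f (dep-mechanism pa⊆s₁)) dep-g₁)
    step false (right s₁v pa⊆s₂) d det-d f g dep-f dep-g =
      let f₁ , f≈ , dep-f₁ = dep-strengthen s₁v dep-f
      in integrate (Marginalised.reduce-right d f g f≈)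
           (ih d det-d f₁ (g ∘ ext mechanism) dep-f₁ (dep-ext dep-g (dep-mechanism pa⊆s₂)))
    step false (neither s₁v s₂v) d det-d f g dep-f dep-g =
      let f₁ , f≈ , dep-f₁ = dep-strengthen s₁v dep-f
          g₁ , g≈ , dep-g₁ = dep-strengthen s₂v dep-g
      in integrate (Marginalised.reduce-neither d f g f≈ g≈) (ih d det-d f₁ g₁ dep-f₁ dep-g₁)
    step true (separator (inj₁ pa⊆s₁)) d det-d f g dep-f dep-g =
      integrate reduce-left
        (ih d′ det-d′ (q · (f ∘ ext γ)) (g ∘ ext γ) (dep-q· pa⊆s₁ (dep-ext dep-f dep-γ)) (dep-ext dep-g dep-γ))
      where open Conditioned d det-d f g
    step true (separator (inj₂ pa⊆s₂)) d det-d f g dep-f dep-g =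
      integrate reduce-right
        (ih d′ det-d′ (f ∘ ext γ) (q · (g ∘ ext γ)) (dep-ext dep-f dep-γ) (dep-q· pa⊆s₂ (dep-ext dep-g dep-γ)))
      where open Conditioned d det-d f g

  build-splits : ∀ L (cs : Channels L) → ConditionalSplits L (build L cs) (keep w L) (marg w L)
  build-splits [] cs d det-d f g _ _ = splits (begin
    (weight id d · ⟨ f , g ⟩) ∘ (id ⊗₁ id)          ≈⟨ ≈-trans (refl⟩∘⟨ ⊗-id) identityʳ ⟩
    weight id d · ⟨ f , g ⟩                         ≈⟨ ·-cong trivial ≈-refl ⟩
    ε · ⟨ f , g ⟩                                   ≈⟨ unitˡ-⟨⟩ ⟩
    ⟨ f , g ⟩                                       ∎)
    where
    trivial : weight id d ≈ ε
    trivial = ≈-trans (∘-resp-≈ cap-I (⟨⟩-cong (ε-unique (discard (det-∘ det-id det-π₁)))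
      (ε-unique (discard (det-∘ det-d det-π₂))))) unitˡ-⟨⟩
  build-splits (v ∷ L) ((c , ch) , cs) =
    Step.step v L (build L cs) c ch (build-splits L cs) (w v) (roles v)

-- Decidable reachability in a finite relation.

module FiniteStar {a r : Level} {A : Set a} (R : A → A → Set r)
                  (_≟_ : (x y : A) → Dec (x ≡ y)) (R? : (x y : A) → Dec (R x y))
                  (elements : List A) (complete : (x : A) → x ∈ˡ elements) where

  -- Floyd–Warshall: only the listed intermediate points may be visited.
  Via : List A → A → A → Set (a ⊔ r)
  Via []       x y = x ≡ y ⊎ R x y
  Via (k ∷ ks) x y = Via ks x y ⊎ (Via ks x k × Via ks k y)

  via? : ∀ ks x y → Dec (Via ks x y)
  via? []       x y = (x ≟ y) ⊎-dec R? x y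
  via? (k ∷ ks) x y = via? ks x y ⊎-dec (via? ks x k ×-dec via? ks k y)

  via⇒star : ∀ ks {x y} → Via ks x y → Star R x y
  via⇒star []       (inj₁ refl)    = stop
  via⇒star []       (inj₂ r)       = r ◅ stop
  via⇒star (k ∷ ks) (inj₁ p)       = via⇒star ks p
  via⇒star (k ∷ ks) (inj₂ (p , q)) = via⇒star ks p ◅◅ via⇒star ks q

  direct : ∀ ks {x y} → Via [] x y → Via ks x y
  direct []       p = p
  direct (k ∷ ks) p = inj₁ (direct ks p)

  -- When `k` is the current pivot, only the piece up to it and the piece from it are kept; loops at
  -- `k` are dropped. For a deeper `k` the induction joins the pieces that meet at it.
  via-trans : ∀ {ks k x y} → k ∈ˡ ks → Via ks x k → Via ks k y → Via ks x y
  via-trans (here refl) (inj₁ p)       (inj₁ q)       = inj₂ (p , q)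
  via-trans (here refl) (inj₁ p)       (inj₂ (_ , q)) = inj₂ (p , q)
  via-trans (here refl) (inj₂ (p , _)) (inj₁ q)       = inj₂ (p , q)
  via-trans (here refl) (inj₂ (p , _)) (inj₂ (_ , q)) = inj₂ (p , q)
  via-trans (there i)   (inj₁ p)       (inj₁ q)       = inj₁ (via-trans i p q)
  via-trans (there i)   (inj₁ p)       (inj₂ (q , s)) = inj₂ (via-trans i p q , s)
  via-trans (there i)   (inj₂ (p , q)) (inj₁ s)       = inj₂ (p , via-trans i q s)
  via-trans (there i)   (inj₂ (p , _)) (inj₂ (_ , s)) = inj₂ (p , s)

  star⇒via : ∀ {x y} → Star R x y → Via elements x y
  star⇒via stop       = direct elements (inj₁ refl)
  star⇒via (r ◅ s) = via-trans (complete _) (direct elements (inj₂ r)) (star⇒via s)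

  star? : ∀ x y → Dec (Star R x y)
  star? x y = map′ (via⇒star elements) star⇒via (via? elements x y)

module _ {n : ℕ} (E : Fin n → Fin n → Bool) where
  open Graph E

  topOrder⇒asym : ∀ {τ} → IsTopOrder τ → ∀ {u v} → Edge u v → Edge v u → ⊥
  topOrder⇒asym {τ} (perm , ordered) {u} {v} uv vu =
    <-asym (ordered (pos u) (pos v) (subst₂ Edge (at u) (at v) uv))
           (ordered (pos v) (pos u) (subst₂ Edge (at v) (at u) vu))
    where
    member : ∀ x → x ∈ˡ τ
    member x = ∈-resp-↭ (↭-sym perm) (∈-allFin x)
    pos = λ x → index (member x)
    at = λ x → lookup-index (member x)

-- Active trails and the separation they define.

module ActiveTrails {n : ℕ} (E : Fin n → Fin n → Bool)
                    (asym : {u v : Fin n} → Graph.Edge E u v → Graph.Edge E v u → ⊥)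
                    (Y Z W : Subset n) where
  open Graph E

  edge? : ∀ u v → Dec (Edge u v)
  edge? u v = E u v ≟ᵇ true

  descendant? : ∀ u v → Dec (Descendant u v)
  descendant? = FiniteStar.star? Edge _≟ᶠ_ edge? (allFin n) ∈-allFin

  Ancestor : Subset n → Fin n → Set
  Ancestor S v = ∃[ d ] (Descendant v d × d ∈ S)

  ancestor? : ∀ S v → Dec (Ancestor S v)
  ancestor? S v = any? λ d → descendant? v d ×-dec (d ∈? S)

  ancestor-edge : ∀ {S u v} → Edge u v → Ancestor S v → Ancestor S u
  ancestor-edge e (d , p , i) = d , e ◅ p , i

  -- A walk is tracked together with a mark saying whether its last edge points into the
  -- current vertex, since that decides whether the vertex is a collider.
  State : Set
  State = Fin n × Bool

  private variable
    u v z : Fin n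
    m m′ : Bool
    xs : List (Fin n)

  -- Activity is tested at the vertex being left, when both of its edges are known. The mark `true`
  -- followed by an edge traversed backwards is a collider; every other combination is a chain or a
  -- fork. A start with mark `false` counts as a non-collider.
  data Step : State → State → Set where
    forward  : Edge u v → u ∉ W → Step (u , m) (v , true)
    backward : Edge v u → u ∉ W → Step (u , false) (v , false)
    collide  : Edge v u → Ancestor W u → Step (u , true) (v , false)

  step? : ∀ s t → Dec (Step s t)
  step? (u , m) (v , true) =
    map′ (uncurry forward) (λ { (forward e p) → e , p }) (edge? u v ×-dec ¬? (u ∈? W))
  step? (u , false) (v , false) =
    map′ (uncurry backward) (λ { (backward e p) → e , p }) (edge? v u ×-dec ¬? (u ∈? W))
  step? (u , true) (v , false) =
    map′ (uncurry collide) (λ { (collide e p) → e , p }) (edge? v u ×-dec ancestor? W u)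

  _≟ˢ_ : ∀ (s t : State) → Dec (s ≡ t)
  (u , m) ≟ˢ (v , m′) = map′ (λ { (refl , refl) → refl }) (λ { refl → refl , refl })
                             ((u ≟ᶠ v) ×-dec (m ≟ᵇ m′))

  walk? : ∀ s t → Dec (Star Step s t)
  walk? = FiniteStar.star? Step _≟ˢ_ step? (cartesianProduct (allFin n) (true ∷ false ∷ []))
    λ { (u , m) → ∈-cartesianProduct⁺ (∈-allFin u) (bool m) }
    where
    bool : ∀ m → m ∈ˡ (true ∷ false ∷ [])
    bool true  = here refl
    bool false = there (here refl)

  data Trail (z : Fin n) : Fin n → Bool → List (Fin n) → Set where
    done : Trail z z m []
    step : Step (u , m) (v , m′) → Trail z v m′ xs → Trail z u m (v ∷ xs)

  -- If the mark at the cut changes from an arrowhead, some collider below v is active.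
  cut : Trail z v m xs → Unique (v ∷ xs) → u ∈ˡ (v ∷ xs) →
        ∃[ m″ ] ∃[ ys ] (Trail z u m″ ys × Unique (u ∷ ys) × (m ≡ true → Ancestor W v ⊎ m″ ≡ true))
  cut t uniq (here refl) = _ , _ , t , uniq , inj₂
  cut (step s t) (_ ∷ uniq) (there i) with cut t uniq i
  ... | m″ , ys , t′ , uniq′ , mark = m″ , ys , t′ , uniq′ , remark s mark
    where
    remark : Step (u , m) (v , m′) → (m′ ≡ true → Ancestor W v ⊎ m″ ≡ true) →
             m ≡ true → Ancestor W u ⊎ m″ ≡ true
    remark (forward e _) mark _ with mark refl
    ... | inj₁ a  = inj₁ (ancestor-edge e a)
    ... | inj₂ eq = inj₂ eq
    remark (collide _ a) _ _ = inj₁ a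

  -- After a loop at `u` is removed, the next step must be retyped for the old mark, exchanging at
  -- most `backward` and `collide`. If `u` becomes a collider, the discarded step `s` or an active
  -- collider in the loop makes it an ancestor of `W`; if it stops being one, `s` supplies `u ∉ W`.
  reenter : Step (u , m) (v , m′) → ∀ {m″} → (m′ ≡ true → Ancestor W v ⊎ m″ ≡ true) →
            Trail z u m″ xs → Trail z u m xs
  reenter s mark done = done
  reenter s mark (step (forward e p) t) = step (forward e p) t
  reenter (forward {m = false} _ _) mark (step (backward e p) t) = step (backward e p) t
  reenter (forward {m = true} f _) mark (step (backward e p) t) with mark refl
  ... | inj₁ a = step (collide e (ancestor-edge f a)) t
  reenter (backward _ _) mark (step (backward e p) t) = step (backward e p) t
  reenter (collide _ a) mark (step (backward e p) t) = step (collide e a) t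
  reenter (forward {m = false} _ p) mark (step (collide e a) t) = step (backward e p) t
  reenter (forward {m = true} _ _) mark (step (collide e a) t) = step (collide e a) t
  reenter (backward _ p) mark (step (collide e a) t) = step (backward e p) t
  reenter (collide _ _) mark (step (collide e a) t) = step (collide e a) t

  open DecMembership (_≟ᶠ_ {n}) using () renaming (_∈?_ to _∈ˡ?_)

  -- Repetitions are removed from the far end: if `u` recurs in the simplified rest, the trail is
  -- cut at the recurrence and restarted with the original mark.
  simplify : Star Step (u , m) (z , m′) → ∃[ xs ] (Trail z u m xs × Unique (u ∷ xs))
  simplify stop = [] , done , [] ∷ []
  simplify {u = u} (_◅_ {j = v , _} s walk) with simplify walk
  ... | xs , t , uniq with u ∈ˡ? (v ∷ xs)
  ...   | no u∉ = v ∷ xs , step s t , ¬Any⇒All¬ _ u∉ ∷ uniq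
  ...   | yes i with cut t uniq i
  ...     | _ , ys , t′ , uniq′ , mark = ys , reenter s mark t′ , uniq′

  step⇒adjacent : Step (u , m) (v , m′) → Adjacent u v
  step⇒adjacent (forward e _)  = inj₁ e
  step⇒adjacent (backward e _) = inj₂ e
  step⇒adjacent (collide e _)  = inj₂ e

  trail-linked : Trail z u m xs → Linked Adjacent (u ∷ xs)
  trail-linked done                = [-]
  trail-linked (step s done)       = step⇒adjacent s ∷ [-]
  trail-linked (step s (step r t)) = step⇒adjacent s ∷ trail-linked (step r t)

  trail-ends : Trail z u m xs → last (u ∷ xs) ≡ just z
  trail-ends done                = refl
  trail-ends (step s done)       = refl
  trail-ends (step s (step r t)) = trail-ends (step r t)

  -- The steps orient both edges at `c`. By asymmetry `BlocksAt` cannot read an edge the other way,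
  -- so its clause must match the steps, whose side conditions refute it.
  step-unblocked : ∀ {a b c k k′ k″} → Step (a , k) (c , k′) → Step (c , k′) (b , k″) → ¬ BlocksAt W a c b
  step-unblocked _ (forward _ p) (inj₁ (i , _)) = p i
  step-unblocked _ (backward _ p) (inj₁ (i , _)) = p i
  step-unblocked (forward _ _) (collide e _) (inj₁ (_ , inj₁ (_ , f))) = asym e f
  step-unblocked (forward e _) (collide _ _) (inj₁ (_ , inj₂ (inj₁ (_ , f)))) = asym e f
  step-unblocked (forward e _) (collide _ _) (inj₁ (_ , inj₂ (inj₂ (f , _)))) = asym e f
  step-unblocked _ (forward e _) (inj₂ ((_ , f) , _)) = asym e f
  step-unblocked (backward e _) (backward _ _) (inj₂ ((f , _) , _)) = asym e f
  step-unblocked (collide e _) (backward _ _) (inj₂ ((f , _) , _)) = asym e f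
  step-unblocked _ (collide _ (d , p , i)) (inj₂ (_ , none)) = none d p i

  trail-unblocked : ∀ {a b c} → Trail z u m xs → Consecutive a c b (u ∷ xs) → ¬ BlocksAt W a c b
  trail-unblocked (step s (step r t)) here      = step-unblocked s r
  trail-unblocked (step s t)          (there i) = trail-unblocked t i

  -- A walk tests only the vertices that it leaves, so its endpoint has to be required outside `W`
  -- separately.
  Reachable : Fin n → Set
  Reachable v = v ∉ W × ∃[ y ] (y ∈ Y × ∃[ m ] Star Step (y , false) (v , m))

  reachable? : ∀ v → Dec (Reachable v)
  reachable? v = ¬? (v ∈? W) ×-dec any? λ y → (y ∈? Y) ×-dec
    map′ (λ { (inj₁ p) → true , p ; (inj₂ p) → false , p })
         (λ { (true , p) → inj₁ p ; (false , p) → inj₂ p })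
         (walk? (y , false) (v , true) ⊎-dec walk? (y , false) (v , false))

  Relevant : Fin n → Set
  Relevant v = Ancestor Y v ⊎ Ancestor Z v ⊎ Ancestor W v

  relevant? : ∀ v → Dec (Relevant v)
  relevant? v = ancestor? Y v ⊎-dec (ancestor? Z v ⊎-dec ancestor? W v)

  relevant-edge : Edge u v → Relevant v → Relevant u
  relevant-edge e (inj₁ a)        = inj₁ (ancestor-edge e a)
  relevant-edge e (inj₂ (inj₁ a)) = inj₂ (inj₁ (ancestor-edge e a))
  relevant-edge e (inj₂ (inj₂ a)) = inj₂ (inj₂ (ancestor-edge e a))

  ∈⇒ancestor : ∀ {S} → v ∈ S → Ancestor S v
  ∈⇒ancestor i = _ , stop , i

  -- No vertex of the directed path lies in `W`, since otherwise `v` would be an ancestor of `W`; so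
  -- every step along it is active. `ascend` uses the same fact in reverse.
  descend : Star Edge v z → ¬ Ancestor W v → ∃[ m′ ] Star Step (v , m) (z , m′)
  descend stop       _  = _ , stop
  descend (e ◅ p) na with descend p (λ a → na (ancestor-edge e a))
  ... | m′ , walk = m′ , forward e (λ i → na (∈⇒ancestor i)) ◅ walk

  ascend : Star Edge v z → ¬ Ancestor W v → Star Step (z , false) (v , false)
  ascend stop       _  = stop
  ascend (e ◅ p) na = ascend p (λ a → na (ancestor-edge e a))
    ◅◅ (backward e (λ i → na (ancestor-edge e (∈⇒ancestor i))) ◅ stop)

  module Separation (dsep : DSeparated Y Z W) (Y∩W : Disjoint Y W) where

    disconnected : ∀ {y z} → y ∈ Y → z ∈ Z → ¬ Star Step (y , false) (z , m)
    disconnected {y = y} {z} y∈ z∈ walk with simplify walk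
    ... | xs , t , uniq
      with dsep y z y∈ z∈ (record { verts = xs ; linked = trail-linked t ; simple = uniq ; ends = trail-ends t })
    ... | _ , _ , _ , cons , blocks = trail-unblocked t cons blocks

    -- A collider v that is not an ancestor of W is one of Y or of Z: in the first case the
    -- trail is restarted at that vertex of Y, in the second Y would be connected to Z.
    reachable-parent : Edge u v → Relevant v → Reachable v → u ∉ W → Reachable u
    reachable-parent {v = v} e rel (v∉W , y , y∈ , false , walk) u∉W =
      u∉W , y , y∈ , _ , walk ◅◅ (backward e v∉W ◅ stop)
    reachable-parent {v = v} e rel (v∉W , y , y∈ , true , walk) u∉W with ancestor? W v
    ... | yes a = u∉W , y , y∈ , _ , walk ◅◅ (collide e a ◅ stop)
    ... | no na with rel
    ...   | inj₁ (y′ , p , y′∈) = u∉W , y′ , y′∈ , _ , ascend p na ◅◅ (backward e v∉W ◅ stop)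
    ...   | inj₂ (inj₁ (z , p , z∈)) = contradiction (walk ◅◅ proj₂ (descend p na)) (disconnected y∈ z∈)
    ...   | inj₂ (inj₂ a) = contradiction a na

    reachable-child : Edge u v → Reachable u → v ∉ W → Reachable v
    reachable-child e (u∉W , y , y∈ , _ , walk) v∉W = v∉W , y , y∈ , _ , walk ◅◅ (forward e u∉W ◅ stop)

    -- This is the moral edge between two parents of an observed vertex: `c` is an open collider.
    reachable-coparent : ∀ {c} → Edge u c → Edge v c → c ∈ W → Reachable u → v ∉ W → Reachable v
    reachable-coparent e f c∈W (u∉W , y , y∈ , _ , walk) v∉W =
      v∉W , y , y∈ , _ , walk ◅◅ (forward e u∉W ◅ collide f (∈⇒ancestor c∈W) ◅ stop)

    Side₁ Side₂ : Fin n → Set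
    Side₁ v = v ∈ W ⊎ (Reachable v × Relevant v)
    Side₂ v = v ∈ W ⊎ (¬ Reachable v × Relevant v)

    side₁? : ∀ v → Dec (Side₁ v)
    side₁? v = (v ∈? W) ⊎-dec (reachable? v ×-dec relevant? v)

    side₂? : ∀ v → Dec (Side₂ v)
    side₂? v = (v ∈? W) ⊎-dec (¬? (reachable? v) ×-dec relevant? v)

    side₁ side₂ : Fin n → Bool
    side₁ v = does (side₁? v)
    side₂ v = does (side₂? v)

    Y⊆side₁ : ∀ v → vlookup Y v ≡ true → side₁ v ≡ true
    Y⊆side₁ v eq = dec-true (side₁? v) (inj₂ ((Y∩W v v∈Y , v , v∈Y , _ , stop) , inj₁ (∈⇒ancestor v∈Y)))
      where v∈Y = lookup⇒[]= v Y eq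

    Z⊆side₂ : ∀ v → vlookup Z v ≡ true → side₂ v ≡ true
    Z⊆side₂ v eq = dec-true (side₂? v) (inj₂ ((λ { (_ , y , y∈ , _ , walk) → disconnected y∈ v∈Z walk })
                                             , inj₂ (inj₁ (∈⇒ancestor v∈Z))))
      where v∈Z = lookup⇒[]= v Z eq

    unless-observed : {P : Set} → (u ∉ W → P) → u ∈ W ⊎ P
    unless-observed {u = u} p with u ∈? W
    ... | yes i = inj₁ i
    ... | no ¬i = inj₂ (p ¬i)

    side-parents₁ : (∀ u → Edge u v → u ∉ W → Reachable u) → Relevant v → ParentsIn E side₁ v
    side-parents₁ reach rel u e =
      dec-true (side₁? u) (unless-observed λ u∉W → reach u e u∉W , relevant-edge e rel)

    side-parents₂ : (∀ u → Edge u v → u ∉ W → ¬ Reachable u) → Relevant v → ParentsIn E side₂ v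
    side-parents₂ reach rel u e =
      dec-true (side₂? u) (unless-observed λ u∉W → reach u e u∉W , relevant-edge e rel)

    -- One reachable parent makes all unobserved parents reachable, by `reachable-coparent`.
    -- Otherwise none is reachable, so in either case a single side contains all parents.
    role-in : v ∈ W → Role E side₁ side₂ v true
    role-in {v} v∈W with any? (λ u → edge? u v ×-dec reachable? u)
    ... | yes (u , e , r) = separator (inj₁ (side-parents₁
      (λ u′ e′ u′∉W → reachable-coparent e e′ v∈W r u′∉W) (inj₂ (inj₂ (∈⇒ancestor v∈W)))))
    ... | no none = separator (inj₂ (side-parents₂
      (λ u e _ r → none (u , e , r)) (inj₂ (inj₂ (∈⇒ancestor v∈W)))))

    role-out : v ∉ W → Role E side₁ side₂ v false
    role-out {v} v∉W with relevant? v
    ... | no irr = neither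
      (dec-false (side₁? v) λ { (inj₁ i) → v∉W i ; (inj₂ (_ , rel)) → irr rel })
      (dec-false (side₂? v) λ { (inj₁ i) → v∉W i ; (inj₂ (_ , rel)) → irr rel })
    ... | yes rel with reachable? v
    ...   | yes r = left
      (dec-false (side₂? v) λ { (inj₁ i) → v∉W i ; (inj₂ (nr , _)) → nr r })
      (side-parents₁ (λ u e → reachable-parent e rel r) rel)
    ...   | no nr = right
      (dec-false (side₁? v) λ { (inj₁ i) → v∉W i ; (inj₂ (r , _)) → nr r })
      (side-parents₂ (λ u e _ r → nr (reachable-child e r v∉W)) rel)

    role : ∀ v → Role E side₁ side₂ v (vlookup W v)
    role v with vlookup W v in eq
    ... | true  = role-in (lookup⇒[]= v W eq)
    ... | false = role-out λ i → contradiction (trans (sym ([]=⇒lookup i)) eq) λ ()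

-- From a factorised joint to conditional independence.

module GlobalMarkov {o ℓ e : Level} {C : CDCat o ℓ e} (EC : EffectConditioning C)
                    {n : ℕ} (obj : Fin n → CDCat.Obj C) (E : Fin n → Fin n → Bool)
                    (L : List (Fin n)) (ω : CDCat.Hom C (CDCat.I C) (Multi.Vertices.X C obj L))
                    (Y Z W : Subset n) where
  open CDCat C
  open EffectConditioning EC
  open CopyDiscard C
  open HomReasoning
  open EffectAction C
  open Caps EC
  open Marginals C obj
  open Multi C
  open Vertices obj
  open Factorisation E
  open Conditionals EC L ω

  private
    y z w : Fin n → Bool
    y = vlookup Y
    z = vlookup Z
    w = vlookup W

    observe : Hom (X L ⊗₀ X (keep w L)) I
    observe = cap ∘ ⟨ marg w L ∘ π₁ , π₂ ⟩

  joint : Hom (I ⊗₀ X (keep w L)) (X (keep y L) ⊗₀ X (keep z L))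
  joint = capApply (split3 Y Z W L ∘ ω)

  joint-· : joint ≈ (observe · ⟨ marg y L ∘ π₁ , marg z L ∘ π₁ ⟩) ∘ (ω ⊗₁ id)
  joint-· = ≈-trans (capApply-cong (split3-marg Y Z W L ⟩∘⟨refl))
    (≈-trans capApply-⟨⟩ (·-cong ≈-refl (⟨⟩-∘ det-π₁) ⟩∘⟨refl))

  single-· : ∀ S → capApply (split2 S W L ∘ ω) ≈ (observe · (marg (vlookup S) L ∘ π₁)) ∘ (ω ⊗₁ id)
  single-· S = ≈-trans (capApply-cong (split2-marg S W L ⟩∘⟨refl)) capApply-⟨⟩

  -- Before normalisation, marginalising commutes with conditioning: the weight `observe` looks only
  -- at the `W`-marginal, and the discarded `Z`-marginal is a channel.
  π₁-joint : π₁ ∘ joint ≈ capApply (split2 Y W L ∘ ω)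
  π₁-joint = begin
    π₁ ∘ joint                                                                  ≈⟨ refl⟩∘⟨ joint-· ⟩
    π₁ ∘ (observe · ⟨ marg y L ∘ π₁ , marg z L ∘ π₁ ⟩) ∘ (ω ⊗₁ id)              ≈⟨ pullˡ ∘-· ⟩
    (observe · (π₁ ∘ ⟨ marg y L ∘ π₁ , marg z L ∘ π₁ ⟩)) ∘ (ω ⊗₁ id)
      ≈⟨ ·-cong ≈-refl (π₁-⟨⟩ (discard (det-∘ (det-marg z L) det-π₁))) ⟩∘⟨refl ⟩
    (observe · (marg y L ∘ π₁)) ∘ (ω ⊗₁ id)                                     ≈⟨ single-· Y ⟨
    capApply (split2 Y W L ∘ ω)                                                 ∎

  π₂-joint : π₂ ∘ joint ≈ capApply (split2 Z W L ∘ ω)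
  π₂-joint = begin
    π₂ ∘ joint                                                                  ≈⟨ refl⟩∘⟨ joint-· ⟩
    π₂ ∘ (observe · ⟨ marg y L ∘ π₁ , marg z L ∘ π₁ ⟩) ∘ (ω ⊗₁ id)              ≈⟨ pullˡ ∘-· ⟩
    (observe · (π₂ ∘ ⟨ marg y L ∘ π₁ , marg z L ∘ π₁ ⟩)) ∘ (ω ⊗₁ id)
      ≈⟨ ·-cong ≈-refl (π₂-⟨⟩ (discard (det-∘ (det-marg y L) det-π₁))) ⟩∘⟨refl ⟩
    (observe · (marg z L ∘ π₁)) ∘ (ω ⊗₁ id)                                     ≈⟨ single-· Z ⟨
    capApply (split2 Z W L ∘ ω)                                                 ∎

  product⇒condIndep : ∀ {f g} → joint ≈ ⟨ f , g ⟩ → CondIndep Y Z W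
  product⇒condIndep eq = begin
    norm joint ∘ unitˡ⇐
      ≈⟨ norm-marginals eq ⟩∘⟨refl ⟩
    ⟨ norm (π₁ ∘ joint) , norm (π₂ ∘ joint) ⟩ ∘ unitˡ⇐
      ≈⟨ ⟨⟩-cong (norm-resp-≈ π₁-joint) (norm-resp-≈ π₂-joint) ⟩∘⟨refl ⟩
    ⟨ cond (split2 Y W L ∘ ω) , cond (split2 Z W L ∘ ω) ⟩ ∘ unitˡ⇐
      ≈⟨ ⟨⟩-∘ det-unitˡ⇐ ⟩
    ⟨ cond₁ Y W , cond₁ Z W ⟩ ∎

  roles⇒condIndep : {s₁ s₂ : Fin n → Bool} (cs : Channels L) → ω ≈ build L cs →
                    (∀ v → Role E s₁ s₂ v (vlookup W v)) →
                    (∀ v → y v ≡ true → s₁ v ≡ true) → (∀ v → z v ≡ true → s₂ v ≡ true) →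
                    CondIndep Y Z W
  roles⇒condIndep {s₁} {s₂} cs ω≈ roles Y⊆s₁ Z⊆s₂ = product⇒condIndep (begin
    joint
      ≈⟨ joint-· ⟩
    (observe · ⟨ marg y L ∘ π₁ , marg z L ∘ π₁ ⟩) ∘ (ω ⊗₁ id)
      -- Here `Γ` is the object of observed values itself, so `observe` is `weight` at `d = id`.
      ≈⟨ ∘-resp-≈ (·-cong (refl⟩∘⟨ ⟨⟩-cong ≈-refl (≈-sym identityˡ)) ≈-refl) (⊗-resp-≈ ω≈ ≈-refl) ⟩
    (weight (marg w L) id · ⟨ marg y L ∘ π₁ , marg z L ∘ π₁ ⟩) ∘ (build L cs ⊗₁ id)
      ≈⟨ Splits.factorisation (build-splits L cs id det-id (marg y L ∘ π₁) (marg z L ∘ π₁)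
           (dep-marg y Y⊆s₁ L) (dep-marg z Z⊆s₂ L)) ⟩
    ⟨ _ , _ ⟩ ∎)
    where open Factorising EC obj E w s₁ s₂ roles (X (keep w L)) (X (keep y L)) (X (keep z L))

theorem3p20 : ∀ {o ℓ e : Level} (C : CDCat o ℓ e) (EC : EffectConditioning C)
    {n : ℕ} (obj : Fin n → CDCat.Obj C) (E : Fin n → Fin n → Bool)
    (τ : List (Fin n)) → Graph.IsTopOrder E τ →
    (ω : CDCat.Hom C (CDCat.I C) (Multi.Vertices.X C obj (reverse τ))) →
    CDCat.IsNormalisedState C ω →
    Multi.Vertices.Factorisation.Factorises C obj E τ ω →
    (Y Z W : Subset n) → Disjoint Y Z → Disjoint Y W → Disjoint Z W →
    Graph.DSeparated E Y Z W →
    Multi.Vertices.Conditionals.CondIndep C obj EC (reverse τ) ω Y Z W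
theorem3p20 C EC obj E τ order ω _ (cs , ω≈) Y Z W _ Y∩W _ dsep =
  GlobalMarkov.roles⇒condIndep EC obj E (reverse τ) ω Y Z W cs ω≈ role Y⊆side₁ Z⊆side₂
  where
  open ActiveTrails E (topOrder⇒asym E order) Y Z W
  open Separation dsep Y∩W
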